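{- Let $\mathcal{A}=\langle S,s^0,L,\Delta\rangle$ be a probabilistic automaton and let $c\subseteq\{(s,a,\mu)\in\Delta\mid a=\tau,\ \mu\text{ is deterministic}\}$ be a weakly probabilistically confluent set of its $\tau$-transitions. Then the quotient automaton $\mathcal{A}/{\leftrightarrow_c^*}$ and $\mathcal{A}$ are branching probabilistically bisimilar.
   Context: Distributions. $\mathrm{Distr}(S)$ is the set of probability distributions $\mu:S\to[0,1]$, $\sum_{s\in S}\mu(s)=1$, on a countable set $S$. $\mathbb{1}_t$ is the deterministic distribution with $\mathbb{1}_t(t)=1$. For an equivalence relation $R$ on $S$, $\mu\equiv_R\mu'$ means $\mu(C)=\mu'(C)$ for all $C\in S/R$, where $\mu(C)=\sum_{s\in C}\mu(s)$. Probabilistic automata. A probabilistic automaton (PA) is a tuple $\langle S,s^0,L,\Delta\rangle$ with $S$ a countable set of states, $s^0\in S$ initial, $L$ a countable set of actions containing the unobservable action $\tau$, and $\Delta\subseteq S\times L\times\mathrm{Distr}(S)$ a countable transition relation. Write $s\xrightarrow{a}\mu$ for $(s,a,\mu)\in\Delta$, and $s\xrightarrow{a}t$ for $s\xrightarrow{a}\mathbb{1}_t$. Paths and schedulers. A finite path is a sequence $\pi=s_0\,(a_1,\mu_1)\,s_1\,(a_2,\mu_2)\cdots(a_n,\mu_n)\,s_n$ ($n\ge 0$) with $s_{i}\xrightarrow{a_{i+1}}\mu_{i+1}$ and $\mu_{i+1}(s_{i+1})>0$; $\mathrm{last}(\pi)=s_n$. A scheduler $\mathcal{S}$ assigns to every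 finite path $\pi$ a probability distribution over $\{\bot\}\cup\Delta$, giving positive probability only to $\bot$ and to transitions $(s,a,\mu)$ with $s=\mathrm{last}(\pi)$ ($\bot$ means stopping). The probability of $\pi$ from $s$ is defined by $P_s^{\mathcal{S}}(s)=1$, $P_s^{\mathcal{S}}(\pi\,(a,\mu)\,t)=P_s^{\mathcal{S}}(\pi)\cdot\mathcal{S}(\pi)(\mathrm{last}(\pi),a,\mu)\cdot\mu(t)$. A maximal path of $\mathcal{S}$ from $s$ is a finite path from $s$ all of whose transitions are scheduled with positive probability after the corresponding prefix and with $\mathcal{S}(\pi)(\bot)>0$. The final state (sub)distribution is $F^{\mathcal{S}}(s)(s')=\sum_{\pi}P_s^{\mathcal{S}}(\pi)\cdot\mathcal{S}(\pi)(\bot)$, over maximal paths $\pi$ of $\mathcal{S}$ from $s$ with $\mathrm{last}(\pi)=s'$. Branching steps. For an equivalence relation $R$ on $S$, $s\Rightarrow^a_R\mu$ if either (1) $a=\tau$ and $\mu=\mathbb{1}_s$, or (2) there is a scheduler $\mathcal{S}$ with $F^{\mathcal{S}}(s)=\mu$ such that every maximal path $s\,(a_1,\mu_1)\,s_1\cdots(a_n,\mu_n)\,s_n$ of $\mathcal{S}$ from $s$ satisfies $a_n=a$ (in particular $n\ge1$) and $a_i=\tau$, $(s,s_i)\in R$ for all $1\le i<n$. Bisimulation. An equivalence relation $R\subseteq S\times S$ is a branching probabilistic bisimulation if for all $(s,t)\in R$: $s\xrightarrow{a}\mu$ implies $\exists\mu'\in\mathrm{Distr}(S)$ with $t\Rightarrow^a_R\mu'$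 and $\mu\equiv_R\mu'$. States $p,q$ are branching probabilistically bisimilar if $(p,q)\in R$ for some branching probabilistic bisimulation $R$. Two PAs are branching probabilistically bisimilar if their initial states are so in the disjoint union of the two PAs. Confluence. Let $c$ be a set of $\tau$-transitions with deterministic distributions. Write $s\to_c t$ if $(s,\tau,\mathbb{1}_t)\in c$; $s\twoheadrightarrow_c t$ if there is a finite (possibly empty) path of $\to_c$-steps from $s$ to $t$; $s\leftrightarrow_c^* t$ if $s$ and $t$ are connected by finitely many (possibly zero) $\to_c$-steps, each of which may be traversed in either direction (this is an equivalence relation). Let $R_c=\{(s,s')\mid\exists u:\ s\twoheadrightarrow_c u\text{ and }s'\twoheadrightarrow_c u\}$. The set $c$ is weakly probabilistically confluent if $R_c$ is an equivalence relation and, for every path $s\twoheadrightarrow_c t$ and all $a\in L$, $\mu\in\mathrm{Distr}(S)$: $s\xrightarrow{a}\mu$ implies that there is $t'\in S$ with $t\twoheadrightarrow_c t'$ and [($\exists\nu\in\mathrm{Distr}(S)$: $t'\xrightarrow{a}\nu$ and $\mu\equiv_{R_c}\nu$) or ($a=\tau$ and $\mu\equiv_{R_c}\mathbb{1}_{t'}$)]. Quotient. For an equivalence relation $R$ on $S$, $\mathcal{A}/R=\langle S/R,[s^0]_R,L,\Delta_R\rangle$, where $\Delta_R\subseteq S/R\times L\times\mathrm{Distr}(S/R)$ contains $([s]_R,a,\mu)$ if and only if there exist $s'\in[s]_R$ and $\mu'$ with $s'\xrightarrow{a}\mu'$ in $\mathcal{A}$ and $\mu([t]_R)=\sum_{t'\in[t]_R}\mu'(t')$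 for all $[t]_R\in S/R$. -}

module Defs where

open import Axiom.ExcludedMiddle using (ExcludedMiddle)
open import Data.Bool.Base using (Bool; true; false; if_then_else_; T)
open import Data.Empty using (⊥)
open import Data.List.Base using (List; []; _∷_; map; foldr)
open import Data.List.Relation.Unary.All as All using (All; []; _∷_)
open import Data.List.Relation.Unary.AllPairs using ([]; _∷_)
import Data.List.Relation.Unary.Unique.Setoid as Uniqueness
open import Data.Maybe.Base as Maybe using (Maybe; just; nothing)
import Data.Maybe.Relation.Binary.Pointwise as MaybeP
open import Data.Nat.Base using (ℕ; zero; suc)
open import Data.Product.Base using (∃-syntax; Σ-syntax; _×_; _,_)
open import Data.Rational.Base as ℚ using (ℚ; 0ℚ; 1ℚ)
import Data.Rational.Properties as ℚₚ
open import Data.Sum.Base using (_⊎_; inj₁; inj₂)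
open import Data.Sum.Relation.Binary.Pointwise using (_⊎ₛ_; inj₁; inj₂)
open import Data.Unit.Base using (⊤; tt)
open import Function.Base using (_∘_)
open import Level using (0ℓ)
open import Relation.Binary.Bundles using (Setoid)
open import Relation.Binary.Construct.Closure.Equivalence as EqC using (EqClosure)
open import Relation.Binary.Construct.Closure.ReflexiveTransitive using (Star)
open import Relation.Binary.Core using (Rel; _⇒_)
open import Relation.Binary.PropositionalEquality as ≡ using (_≡_; refl)
open import Relation.Binary.Structures using (IsEquivalence)
open import Relation.Nullary using (Dec; yes; no; does; ¬_; contradiction)

-- The mathematics is classical: real numbers, sums over arbitrary countable
-- sets, and schedulers choosing by cases on undecidable properties.  Excluded
-- middle is therefore a parameter.  Since it identifies Set with Bool, cuts can
-- be Bool-valued, which keeps distributions, paths and schedulers small.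
--
-- Sets are setoids, because quotient automata have S / R as their state space.

module Classical (em : ExcludedMiddle 0ℓ) where

  -- x is represented by the set of rationals q with q < x: a rounded lower
  -- set containing all negative rationals.  Classically these are exactly the
  -- elements of [0,∞].

  record ℝ≥0∞ : Set where
    field
      below    : ℚ → Bool
      negative : ∀ {q} → q ℚ.< 0ℚ → T (below q)
      lower    : ∀ {p q} → p ℚ.≤ q → T (below q) → T (below p)
      rounded  : ∀ {q} → T (below q) → ∃[ r ] q ℚ.< r × T (below r)

  open ℝ≥0∞ public

  infix 4 _∋_ _≈ᵣ_

  _∋_ : ℝ≥0∞ → ℚ → Set
  x ∋ q = T (below x q)

  record _≈ᵣ_ (x y : ℝ≥0∞) : Set where
    constructor mk≈ᵣ
    field
      to   : ∀ {q} → x ∋ q → y ∋ q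
      from : ∀ {q} → y ∋ q → x ∋ q

  open _≈ᵣ_ public

  ≈ᵣ-refl : ∀ {x} → x ≈ᵣ x
  ≈ᵣ-refl = mk≈ᵣ (λ p → p) (λ p → p)

  ≈ᵣ-sym : ∀ {x y} → x ≈ᵣ y → y ≈ᵣ x
  ≈ᵣ-sym e = mk≈ᵣ (from e) (to e)

  ≈ᵣ-trans : ∀ {x y z} → x ≈ᵣ y → y ≈ᵣ z → x ≈ᵣ z
  ≈ᵣ-trans e f = mk≈ᵣ (to f ∘ to e) (from e ∘ from f)

  -- Opaque, here and below, only for the speed of type checking: the
  -- introduction and elimination lemmas characterise each operation.
  opaque
    ⌊_⌋ : Set → Bool
    ⌊ P ⌋ = does (em {P})

    ⌊⌋-intro : ∀ {P : Set} → P → T ⌊ P ⌋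
    ⌊⌋-intro {P} p with em {P}
    ... | yes _ = tt
    ... | no ¬p = ¬p p

    ⌊⌋-elim : ∀ {P : Set} → T ⌊ P ⌋ → P
    ⌊⌋-elim {P} t with em {P}
    ... | yes p = p

  cut : (P : ℚ → Set) →
        (∀ {q} → q ℚ.< 0ℚ → P q) →
        (∀ {p q} → p ℚ.≤ q → P q → P p) →
        (∀ {q} → P q → ∃[ r ] q ℚ.< r × P r) →
        ℝ≥0∞
  cut P neg low rnd = record
    { below    = λ q → ⌊ P q ⌋
    ; negative = λ q<0 → ⌊⌋-intro (neg q<0)
    ; lower    = λ p≤q t → ⌊⌋-intro (low p≤q (⌊⌋-elim t))
    ; rounded  = λ t → let r , q<r , Pr = rnd (⌊⌋-elim t) in r , q<r , ⌊⌋-intro Pr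
    }

  opaque
    0ᵣ : ℝ≥0∞
    0ᵣ = cut (ℚ._< 0ℚ) (λ q<0 → q<0) ℚₚ.≤-<-trans
           (λ q<0 → let r , q<r , r<0 = ℚₚ.<-dense q<0 in r , q<r , r<0)

    1ᵣ : ℝ≥0∞
    1ᵣ = cut (ℚ._< 1ℚ) (λ q<0 → ℚₚ.<-trans q<0 (ℚₚ.positive⁻¹ 1ℚ)) ℚₚ.≤-<-trans
           (λ q<1 → let r , q<r , r<1 = ℚₚ.<-dense q<1 in r , q<r , r<1)

    0ᵣ-intro : ∀ {q} → q ℚ.< 0ℚ → 0ᵣ ∋ q
    0ᵣ-intro = ⌊⌋-intro

    0ᵣ-elim : ∀ {q} → 0ᵣ ∋ q → q ℚ.< 0ℚ
    0ᵣ-elim = ⌊⌋-elim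

    1ᵣ-intro : ∀ {q} → q ℚ.< 1ℚ → 1ᵣ ∋ q
    1ᵣ-intro = ⌊⌋-intro

    1ᵣ-elim : ∀ {q} → 1ᵣ ∋ q → q ℚ.< 1ℚ
    1ᵣ-elim = ⌊⌋-elim

  -- The indicator of a proposition.
  χ : Set → ℝ≥0∞
  χ P = if ⌊ P ⌋ then 1ᵣ else 0ᵣ

  χ-yes : ∀ {P : Set} → P → χ P ≈ᵣ 1ᵣ
  χ-yes {P} p with ⌊ P ⌋ | ⌊⌋-intro {P} p
  ... | true | _ = ≈ᵣ-refl

  χ-no : ∀ {P : Set} → ¬ P → χ P ≈ᵣ 0ᵣ
  χ-no {P} ¬p with ⌊ P ⌋ | ⌊⌋-elim {P}
  ... | true  | e = contradiction (e tt) ¬p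
  ... | false | _ = ≈ᵣ-refl

  private
    χ-cong : ∀ {P Q : Set} → (P → Q) → (Q → P) → χ P ≈ᵣ χ Q
    χ-cong {P} {Q} f g = case (em {P})
      where
      case : Dec P → χ P ≈ᵣ χ Q
      case (yes p) = ≈ᵣ-trans (χ-yes p) (≈ᵣ-sym (χ-yes (f p)))
      case (no ¬p) = ≈ᵣ-trans (χ-no ¬p) (≈ᵣ-sym (χ-no (¬p ∘ g)))

  Pos : ℝ≥0∞ → Set
  Pos x = x ∋ 0ℚ

  private
    <-split : ∀ {p q} → p ℚ.< q → p ℚ.- q ℚ.< 0ℚ
    <-split {p} {q} p<q = ≡.subst (p ℚ.- q ℚ.<_) (ℚₚ.+-inverseʳ q) (ℚₚ.+-monoˡ-< (ℚ.- q) p<q)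

    +-cancel : ∀ q m → m ℚ.+ (q ℚ.- m) ≡ q
    +-cancel q m = begin
      m ℚ.+ (q ℚ.- m)        ≡⟨ ℚₚ.+-comm m (q ℚ.- m) ⟩
      (q ℚ.- m) ℚ.+ m        ≡⟨ ℚₚ.+-assoc q (ℚ.- m) m ⟩
      q ℚ.+ (ℚ.- m ℚ.+ m)    ≡⟨ ≡.cong (q ℚ.+_) (ℚₚ.+-inverseˡ m) ⟩
      q ℚ.+ 0ℚ               ≡⟨ ℚₚ.+-identityʳ q ⟩
      q                      ∎
      where open ≡.≡-Reasoning

    split : ∀ {q b} → q ℚ.< b → ∃[ m ] m ℚ.< b × (q ℚ.- m ℚ.< 0ℚ) × q ℚ.≤ m ℚ.+ (q ℚ.- m)
    split {q} q<b =
      let m , q<m , m<b = ℚₚ.<-dense q<b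
      in m , m<b , <-split q<m , ℚₚ.≤-reflexive (≡.sym (+-cancel q m))

  infixl 6 _+ᵣ_
  infixl 7 _*ᵣ_

  opaque
    _+ᵣ_ : ℝ≥0∞ → ℝ≥0∞ → ℝ≥0∞
    x +ᵣ y = cut
      (λ q → ∃[ a ] ∃[ b ] x ∋ a × y ∋ b × q ℚ.≤ a ℚ.+ b)
      (λ q<0 → let m , m<0 , n<0 , le = split q<0 in
                 m , _ , negative x m<0 , negative y n<0 , le)
      (λ p≤q (a , b , xa , yb , le) → a , b , xa , yb , ℚₚ.≤-trans p≤q le)
      (λ (a , b , xa , yb , le) → let a′ , a<a′ , xa′ = rounded x xa in
         a′ ℚ.+ b , ℚₚ.≤-<-trans le (ℚₚ.+-monoˡ-< b a<a′) ,
         a′ , b , xa′ , yb , ℚₚ.≤-refl)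

    +ᵣ-intro : ∀ {x y q} → ∃[ a ] ∃[ b ] x ∋ a × y ∋ b × q ℚ.≤ a ℚ.+ b → x +ᵣ y ∋ q
    +ᵣ-intro = ⌊⌋-intro

    +ᵣ-elim : ∀ {x y q} → x +ᵣ y ∋ q → ∃[ a ] ∃[ b ] x ∋ a × y ∋ b × q ℚ.≤ a ℚ.+ b
    +ᵣ-elim = ⌊⌋-elim

  private
    *-mono-< : ∀ {a a′ b b′} → 0ℚ ℚ.≤ a → 0ℚ ℚ.≤ b → a ℚ.< a′ → b ℚ.< b′ →
               a ℚ.* b ℚ.< a′ ℚ.* b′
    *-mono-< {a} {a′} {b} {b′} 0≤a 0≤b a<a′ b<b′ =
      ℚₚ.≤-<-trans
        (ℚₚ.*-monoˡ-≤-nonNeg a {{ℚ.nonNegative 0≤a}} (ℚₚ.<⇒≤ b<b′))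
        (ℚₚ.*-monoˡ-<-pos b′ {{ℚ.positive (ℚₚ.≤-<-trans 0≤b b<b′)}} a<a′)

  opaque
    _*ᵣ_ : ℝ≥0∞ → ℝ≥0∞ → ℝ≥0∞
    x *ᵣ y = cut
      (λ q → q ℚ.< 0ℚ ⊎
             (∃[ a ] ∃[ b ] 0ℚ ℚ.≤ a × 0ℚ ℚ.≤ b × x ∋ a × y ∋ b × q ℚ.≤ a ℚ.* b))
      inj₁
      (λ { p≤q (inj₁ q<0) → inj₁ (ℚₚ.≤-<-trans p≤q q<0)
         ; p≤q (inj₂ (a , b , 0≤a , 0≤b , xa , yb , le)) →
             inj₂ (a , b , 0≤a , 0≤b , xa , yb , ℚₚ.≤-trans p≤q le) })
      (λ { (inj₁ q<0) → let r , q<r , r<0 = ℚₚ.<-dense q<0 in r , q<r , inj₁ r<0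
         ; (inj₂ (a , b , 0≤a , 0≤b , xa , yb , le)) →
             let a′ , a<a′ , xa′ = rounded x xa
                 b′ , b<b′ , yb′ = rounded y yb
             in a′ ℚ.* b′ , ℚₚ.≤-<-trans le (*-mono-< 0≤a 0≤b a<a′ b<b′) ,
                inj₂ (a′ , b′ , ℚₚ.<⇒≤ (ℚₚ.≤-<-trans 0≤a a<a′) ,
                      ℚₚ.<⇒≤ (ℚₚ.≤-<-trans 0≤b b<b′) , xa′ , yb′ , ℚₚ.≤-refl) })

    *ᵣ-intro : ∀ {x y q} →
      q ℚ.< 0ℚ ⊎
      (∃[ a ] ∃[ b ] 0ℚ ℚ.≤ a × 0ℚ ℚ.≤ b × x ∋ a × y ∋ b × q ℚ.≤ a ℚ.* b) →
      x *ᵣ y ∋ q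
    *ᵣ-intro = ⌊⌋-intro

    *ᵣ-elim : ∀ {x y q} → x *ᵣ y ∋ q →
      q ℚ.< 0ℚ ⊎
      (∃[ a ] ∃[ b ] 0ℚ ℚ.≤ a × 0ℚ ℚ.≤ b × x ∋ a × y ∋ b × q ℚ.≤ a ℚ.* b)
    *ᵣ-elim = ⌊⌋-elim

  sumList : {A : Set} → (A → ℝ≥0∞) → List A → ℝ≥0∞
  sumList f = foldr (λ x → f x +ᵣ_) 0ᵣ

  sumList-cong : {A : Set} {f g : A → ℝ≥0∞} → (∀ x → f x ≈ᵣ g x) → ∀ xs {q} →
                 sumList f xs ∋ q → sumList g xs ∋ q
  sumList-cong e []       h = h
  sumList-cong e (x ∷ xs) h =
    let a , b , ha , hb , le = +ᵣ-elim h
    in +ᵣ-intro (a , b , to (e x) ha , sumList-cong e xs hb , le)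

  -- The sum of f over { x ∈ X | P x }, as the supremum of its finite partial
  -- sums; Unique is up to the equality of X, so each element counts once.
  opaque
    ∑ : (X : Setoid 0ℓ 0ℓ) → (Setoid.Carrier X → Set) → (Setoid.Carrier X → ℝ≥0∞) → ℝ≥0∞
    ∑ X P f = cut
      (λ q → ∃[ xs ] Unique xs × All P xs × sumList f xs ∋ q)
      (λ q<0 → [] , [] , [] , negative 0ᵣ q<0)
      (λ p≤q (xs , u , ps , s) → xs , u , ps , lower (sumList f xs) p≤q s)
      (λ (xs , u , ps , s) → let r , q<r , s′ = rounded (sumList f xs) s in
                               r , q<r , xs , u , ps , s′)
      where open Uniqueness X using (Unique)

  module _ {X : Setoid 0ℓ 0ℓ} {P : Setoid.Carrier X → Set} {f : Setoid.Carrier X → ℝ≥0∞} where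
    open Uniqueness X using (Unique)

    opaque
      unfolding ∑

      ∑-intro : ∀ {q} → ∃[ xs ] Unique xs × All P xs × sumList f xs ∋ q → ∑ X P f ∋ q
      ∑-intro = ⌊⌋-intro

      ∑-elim : ∀ {q} → ∑ X P f ∋ q → ∃[ xs ] Unique xs × All P xs × sumList f xs ∋ q
      ∑-elim = ⌊⌋-elim

  record Distr (X : Setoid 0ℓ 0ℓ) : Set where
    open Setoid X
    field
      mass      : Carrier → ℝ≥0∞
      mass-cong : ∀ {x y} → x ≈ y → mass x ≈ᵣ mass y
      total     : ∑ X (λ _ → ⊤) mass ≈ᵣ 1ᵣ

  open Distr public

  module _ {X : Setoid 0ℓ 0ℓ} where
    open Setoid X
    open Uniqueness X using (Unique)

    infix 4 _≈ᵈ_ _≡[_]_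
    infix 9 _⟨_⟩

    _≈ᵈ_ : Rel (Distr X) 0ℓ
    μ ≈ᵈ ν = ∀ x → mass μ x ≈ᵣ mass ν x

    _⟨_⟩ : Distr X → (Carrier → Set) → ℝ≥0∞
    μ ⟨ C ⟩ = ∑ X C (mass μ)

    ⟨⟩-cong : ∀ {μ ν : Distr X} (C : Carrier → Set) → μ ≈ᵈ ν → μ ⟨ C ⟩ ≈ᵣ ν ⟨ C ⟩
    ⟨⟩-cong C e = mk≈ᵣ
      (λ h → let xs , u , c , s = ∑-elim h in ∑-intro (xs , u , c , sumList-cong e xs s))
      (λ h → let xs , u , c , s = ∑-elim h in
             ∑-intro (xs , u , c , sumList-cong (λ x → ≈ᵣ-sym (e x)) xs s))

    -- The classes of R are the sets R x.
    _≡[_]_ : Distr X → Rel Carrier 0ℓ → Distr X → Set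
    μ ≡[ R ] ν = ∀ x → μ ⟨ R x ⟩ ≈ᵣ ν ⟨ R x ⟩

    private
      δ : Carrier → Carrier → ℝ≥0∞
      δ t s = χ (s ≈ t)

      sum-miss : ∀ {t} xs → All (_≉ t) xs → ∀ {q} → sumList (δ t) xs ∋ q → q ℚ.< 0ℚ
      sum-miss []       []       h = 0ᵣ-elim h
      sum-miss (x ∷ xs) (n ∷ ns) h =
        let a , b , ha , hb , le = +ᵣ-elim h
        in ℚₚ.≤-<-trans le
             (ℚₚ.+-mono-< (0ᵣ-elim (to (χ-no n) ha)) (sum-miss xs ns hb))

      sum-unique : ∀ {t} xs → Unique xs → ∀ {q} → sumList (δ t) xs ∋ q → q ℚ.< 1ℚ
      sum-unique []       []       h = ℚₚ.<-trans (0ᵣ-elim h) (ℚₚ.positive⁻¹ 1ℚ)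
      sum-unique {t} (x ∷ xs) (n ∷ u) {q} h =
        let a , b , ha , hb , le = +ᵣ-elim h in ℚₚ.≤-<-trans le (case (em {x ≈ t}) ha hb)
        where
        case : Dec (x ≈ t) → ∀ {a b} → δ t x ∋ a → sumList (δ t) xs ∋ b → a ℚ.+ b ℚ.< 1ℚ
        case (yes x≈t) ha hb =
          ℚₚ.+-mono-< {y = 1ℚ} {v = 0ℚ} (1ᵣ-elim (to (χ-yes x≈t) ha))
            (sum-miss xs (All.map (λ x≉y y≈t → x≉y (trans x≈t (sym y≈t))) n) hb)
        case (no x≉t) ha hb =
          ℚₚ.+-mono-< {y = 0ℚ} {v = 1ℚ} (0ᵣ-elim (to (χ-no x≉t) ha)) (sum-unique xs u hb)

    𝟙 : Carrier → Distr X
    𝟙 t = record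
      { mass      = λ s → χ (s ≈ t)
      ; mass-cong = λ x≈y → χ-cong (trans (sym x≈y)) (trans x≈y)
      ; total     = mk≈ᵣ
          (λ h → let xs , u , _ , s = ∑-elim h in 1ᵣ-intro (sum-unique xs u s))
          (λ h → let m , m<1 , n<0 , le = split (1ᵣ-elim h) in
                 ∑-intro ( t ∷ [] , [] ∷ [] , tt ∷ [] ,
                   +ᵣ-intro ( m , _ , from (χ-yes {t ≈ t} (Setoid.refl X)) (1ᵣ-intro m<1)
                            , 0ᵣ-intro n<0 , le)))
      }

  -- Finite and empty sets are included: enum may skip indices and repeat itself.
  record Countable (X : Setoid 0ℓ 0ℓ) : Set where
    open Setoid X
    field
      enum : ℕ → Maybe Carrier
      hit  : ∀ x → ∃[ n ] MaybeP.Pointwise _≈_ (enum n) (just x)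

  open Countable public

  private
    interleave : {A : Set} → (ℕ → A) → (ℕ → A) → ℕ → A
    interleave f g zero    = f zero
    interleave f g (suc n) = interleave g (f ∘ suc) n

    mutual
      interleaveˡ : {A : Set} (f g : ℕ → A) → ∀ n → ∃[ k ] interleave f g k ≡ f n
      interleaveˡ f g zero    = zero , refl
      interleaveˡ f g (suc n) = let k , e = interleaveʳ g (f ∘ suc) n in suc k , e

      interleaveʳ : {A : Set} (f g : ℕ → A) → ∀ n → ∃[ k ] interleave f g k ≡ g n
      interleaveʳ f g n = let k , e = interleaveˡ g (f ∘ suc) n in suc k , e

  Countable-⊎ : ∀ {X Y} → Countable X → Countable Y → Countable (X ⊎ₛ Y)
  Countable-⊎ {X} {Y} cX cY = record
    { enum = interleave f g
    ; hit  = λ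
        { (inj₁ x) → let n , p = hit cX x
                         k , e = interleaveˡ f g n
                     in k , ≡.subst (λ m → MaybeP.Pointwise _~_ m (just (inj₁ x))) (≡.sym e) (left p)
        ; (inj₂ y) → let n , p = hit cY y
                         k , e = interleaveʳ f g n
                     in k , ≡.subst (λ m → MaybeP.Pointwise _~_ m (just (inj₂ y))) (≡.sym e) (right p)
        }
    }
    where
    open Setoid (X ⊎ₛ Y) using () renaming (_≈_ to _~_)
    f = Maybe.map inj₁ ∘ enum cX
    g = Maybe.map inj₂ ∘ enum cY
    left : ∀ {m x} → MaybeP.Pointwise (Setoid._≈_ X) m (just x) →
           MaybeP.Pointwise _~_ (Maybe.map inj₁ m) (just (inj₁ x))
    left (MaybeP.just p) = MaybeP.just (inj₁ p)
    right : ∀ {m y} → MaybeP.Pointwise (Setoid._≈_ Y) m (just y) →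
            MaybeP.Pointwise _~_ (Maybe.map inj₂ m) (just (inj₂ y))
    right (MaybeP.just p) = MaybeP.just (inj₂ p)

  Countable-image : ∀ {X Y : Setoid 0ℓ 0ℓ} (G : Setoid.Carrier X → Setoid.Carrier Y → Set) →
    (∀ {x x′ y} → Setoid._≈_ X x′ x → G x y → G x′ y) →
    (∀ {x y y′} → G x y → G x y′ → Setoid._≈_ Y y y′) →
    (∀ y → ∃[ x ] G x y) →
    Countable X → Countable Y
  Countable-image {X} {Y} G resp fun onto cX = record
    { enum = λ n → enum cX n Maybe.>>= pick
    ; hit  = λ y → let x , g = onto y
                       n , p = hit cX x
                   in n , picked p g
    }
    where
    pick : Setoid.Carrier X → Maybe (Setoid.Carrier Y)
    pick x with em {∃[ y ] G x y}
    ... | yes (y , _) = just y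
    ... | no _        = nothing
    picked : ∀ {m x y} → MaybeP.Pointwise (Setoid._≈_ X) m (just x) → G x y →
             MaybeP.Pointwise (Setoid._≈_ Y) (m Maybe.>>= pick) (just y)
    picked {just x′} {y = y} (MaybeP.just x′≈x) g with em {∃[ y ] G x′ y}
    ... | yes (_ , g′) = MaybeP.just (fun g′ (resp x′≈x g))
    ... | no ∄         = contradiction (y , resp x′≈x g) ∄

  record Actions : Set₁ where
    field
      Action    : Set
      τ         : Action
      countable : Countable (≡.setoid Action)

  module _ (L : Actions) where
    open Actions L

    record Transition (X : Setoid 0ℓ 0ℓ)
                      (Δ : Setoid.Carrier X → Action → Distr X → Set) : Set where
      constructor transition
      field
        {src} : Setoid.Carrier X
        {act} : Action
        {tgt} : Distr X
        valid : Δ src act tgt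

    open Transition public

    TransitionSetoid : (X : Setoid 0ℓ 0ℓ) →
                       (Setoid.Carrier X → Action → Distr X → Set) → Setoid 0ℓ 0ℓ
    TransitionSetoid X Δ = record
      { Carrier       = Transition X Δ
      ; _≈_           = λ d e → src d ≈ src e × act d ≡ act e × tgt d ≈ᵈ tgt e
      ; isEquivalence = record
          { refl  = X.refl , refl , λ _ → ≈ᵣ-refl
          ; sym   = λ (p , q , r) → X.sym p , ≡.sym q , λ x → ≈ᵣ-sym (r x)
          ; trans = λ (p , q , r) (p′ , q′ , r′) →
                      X.trans p p′ , ≡.trans q q′ , λ x → ≈ᵣ-trans (r x) (r′ x)
          }
      }
      where
      module X = Setoid X
      open X using (_≈_)

    -- A probabilistic automaton without its initial state.
    record TransitionSystem : Set₁ where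
      field
        states : Setoid 0ℓ 0ℓ
      open Setoid states public using () renaming (Carrier to State)
      open Setoid states using (_≈_)
      field
        Δ                : State → Action → Distr states → Set
        Δ-resp           : ∀ {s s′ a μ μ′} → s ≈ s′ → μ ≈ᵈ μ′ → Δ s a μ → Δ s′ a μ′
        states-countable : Countable states
        Δ-countable      : Countable (TransitionSetoid states Δ)

    record PA : Set₁ where
      field
        system : TransitionSystem
      open TransitionSystem system public
      field
        init : State

  record Equivalence (X : Setoid 0ℓ 0ℓ) (R : Rel (Setoid.Carrier X) 0ℓ) : Set where
    field
      isEquivalence : IsEquivalence R
      contains-≈    : Setoid._≈_ X ⇒ R
    open IsEquivalence isEquivalence public

  module _ {L : Actions} where
    open Actions L

    infix 6 _/_

    -- The states of the quotient are those of the given automaton, compared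
    -- by R; s stands for the class [s].
    _/_ : (A : PA L) {R : Rel (PA.State A) 0ℓ} → Equivalence (PA.states A) R → PA L
    _/_ A {R} eq = record
      { system = record
        { states           = S/R
        ; Δ                = ΔR
        ; Δ-resp           = λ {_} {_} {_} {μ} {μ′} → ΔR-resp {μ = μ} {μ′}
        ; states-countable = Countable-image {states} {S/R} R
            (λ x′≈x r → R.trans (R.contains-≈ x′≈x) r)
            (λ r r′ → R.trans (R.sym r) r′) (λ y → y , R.refl)
            states-countable
        ; Δ-countable      = Countable-image {TransitionSetoid L states Δ} {TransitionSetoid L S/R ΔR}
            G (λ {d} {d′} {e} → G-resp {d} {d′} {e}) (λ {d} {e} {e′} → G-fun {d} {e} {e′})
            G-onto Δ-countable
        }
      ; init   = init
      }
      where
      open PA A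
      module S = Setoid states
      module R = Equivalence eq

      S/R : Setoid 0ℓ 0ℓ
      S/R = record { Carrier = State ; _≈_ = R ; isEquivalence = R.isEquivalence }

      Lumps : Distr S/R → Distr states → Set
      Lumps μ μ′ = ∀ t → mass μ t ≈ᵣ μ′ ⟨ R t ⟩

      ΔR : State → Action → Distr S/R → Set
      ΔR s a μ = ∃[ s′ ] ∃[ μ′ ] R s s′ × Δ s′ a μ′ × Lumps μ μ′

      ΔR-resp : ∀ {s s′ a} {μ μ′ : Distr S/R} → R s s′ → μ ≈ᵈ μ′ → ΔR s a μ → ΔR s′ a μ′
      ΔR-resp r e (u , ν , ru , d , l) =
        u , ν , R.trans (R.sym r) ru , d , λ t → ≈ᵣ-trans (≈ᵣ-sym (e t)) (l t)

      G : Transition L states Δ → Transition L S/R ΔR → Set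
      G d e = R (src e) (src d) × act e ≡ act d × Lumps (tgt e) (tgt d)

      G-resp : ∀ {d d′ e} → Setoid._≈_ (TransitionSetoid L states Δ) d′ d → G d e → G d′ e
      G-resp {d} {d′} (p , q , r) (rs , ae , l) =
        R.trans rs (R.contains-≈ (S.sym p)) , ≡.trans ae (≡.sym q) ,
        λ t → ≈ᵣ-trans (l t) (⟨⟩-cong {states} {tgt d} {tgt d′} (R t) (λ x → ≈ᵣ-sym (r x)))

      G-fun : ∀ {d e e′} → G d e → G d e′ → Setoid._≈_ (TransitionSetoid L S/R ΔR) e e′
      G-fun (p , q , r) (p′ , q′ , r′) =
        R.trans p (R.sym p′) , ≡.trans q (≡.sym q′) , λ t → ≈ᵣ-trans (r t) (≈ᵣ-sym (r′ t))

      G-onto : ∀ e → ∃[ d ] G d e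
      G-onto (transition (s′ , μ′ , r , d , l)) = transition d , r , refl , l

    infixr 5 _⊎ᵗ_

    _⊎ᵗ_ : TransitionSystem L → TransitionSystem L → TransitionSystem L
    A ⊎ᵗ B = record
      { states           = A.states ⊎ₛ B.states
      ; Δ                = Δ⊎
      ; Δ-resp           = resp
      ; states-countable = Countable-⊎ A.states-countable B.states-countable
      ; Δ-countable      = Countable-image {TA ⊎ₛ TB} {T⊎}
          G (λ {d} {d′} {e} → G-resp {d} {d′} {e}) (λ {d} {e} {e′} → G-fun {d} {e} {e′}) G-onto
          (Countable-⊎ A.Δ-countable B.Δ-countable)
      }
      where
      module A = TransitionSystem A
      module B = TransitionSystem B
      module SA = Setoid A.states
      module SB = Setoid B.states
      S⊎ = A.states ⊎ₛ B.states
      module S = Setoid S⊎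

      ExtendsA : Distr S⊎ → Distr A.states → Set
      ExtendsA μ μ₀ = (∀ s → mass μ (inj₁ s) ≈ᵣ mass μ₀ s) × (∀ t → mass μ (inj₂ t) ≈ᵣ 0ᵣ)

      ExtendsB : Distr S⊎ → Distr B.states → Set
      ExtendsB μ μ₀ = (∀ s → mass μ (inj₁ s) ≈ᵣ 0ᵣ) × (∀ t → mass μ (inj₂ t) ≈ᵣ mass μ₀ t)

      Δ⊎ : S.Carrier → Action → Distr S⊎ → Set
      Δ⊎ (inj₁ s) a μ = ∃[ μ₀ ] A.Δ s a μ₀ × ExtendsA μ μ₀
      Δ⊎ (inj₂ t) a μ = ∃[ μ₀ ] B.Δ t a μ₀ × ExtendsB μ μ₀

      resp : ∀ {s s′ a} {μ μ′ : Distr S⊎} → s S.≈ s′ → μ ≈ᵈ μ′ → Δ⊎ s a μ → Δ⊎ s′ a μ′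
      resp (inj₁ p) e (μ₀ , d , x , y) =
        μ₀ , A.Δ-resp p (λ _ → ≈ᵣ-refl) d ,
        (λ s → ≈ᵣ-trans (≈ᵣ-sym (e _)) (x s)) , (λ t → ≈ᵣ-trans (≈ᵣ-sym (e _)) (y t))
      resp (inj₂ p) e (μ₀ , d , x , y) =
        μ₀ , B.Δ-resp p (λ _ → ≈ᵣ-refl) d ,
        (λ s → ≈ᵣ-trans (≈ᵣ-sym (e _)) (x s)) , (λ t → ≈ᵣ-trans (≈ᵣ-sym (e _)) (y t))

      TA = TransitionSetoid L A.states A.Δ
      TB = TransitionSetoid L B.states B.Δ
      T⊎ = TransitionSetoid L S⊎ Δ⊎

      G : Setoid.Carrier (TA ⊎ₛ TB) → Setoid.Carrier T⊎ → Set
      G (inj₁ d) e = src e S.≈ inj₁ (src d) × act e ≡ act d × ExtendsA (tgt e) (tgt d)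
      G (inj₂ d) e = src e S.≈ inj₂ (src d) × act e ≡ act d × ExtendsB (tgt e) (tgt d)

      G-resp : ∀ {d d′ e} → Setoid._≈_ (TA ⊎ₛ TB) d′ d → G d e → G d′ e
      G-resp {e = e} (inj₁ (p , q , r)) (se , ae , x , y) =
        S.trans {src e} se (inj₁ (SA.sym p)) , ≡.trans ae (≡.sym q) ,
        (λ s → ≈ᵣ-trans (x s) (≈ᵣ-sym (r s))) , y
      G-resp {e = e} (inj₂ (p , q , r)) (se , ae , x , y) =
        S.trans {src e} se (inj₂ (SB.sym p)) , ≡.trans ae (≡.sym q) ,
        x , (λ t → ≈ᵣ-trans (y t) (≈ᵣ-sym (r t)))

      agree : ∀ {μ ν : Distr S⊎} {f : A.State → ℝ≥0∞} {g : B.State → ℝ≥0∞} →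
              (∀ s → mass μ (inj₁ s) ≈ᵣ f s) × (∀ t → mass μ (inj₂ t) ≈ᵣ g t) →
              (∀ s → mass ν (inj₁ s) ≈ᵣ f s) × (∀ t → mass ν (inj₂ t) ≈ᵣ g t) →
              μ ≈ᵈ ν
      agree (x , y) (x′ , y′) (inj₁ s) = ≈ᵣ-trans (x s) (≈ᵣ-sym (x′ s))
      agree (x , y) (x′ , y′) (inj₂ t) = ≈ᵣ-trans (y t) (≈ᵣ-sym (y′ t))

      G-fun : ∀ {d e e′} → G d e → G d e′ → Setoid._≈_ T⊎ e e′
      G-fun {inj₁ d} {e} {e′} (p , q , r) (p′ , q′ , r′) =
        S.trans p (S.sym p′) , ≡.trans q (≡.sym q′) , agree {tgt e} {tgt e′} {mass (tgt d)} {λ _ → 0ᵣ} r r′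
      G-fun {inj₂ d} {e} {e′} (p , q , r) (p′ , q′ , r′) =
        S.trans p (S.sym p′) , ≡.trans q (≡.sym q′) , agree {tgt e} {tgt e′} {λ _ → 0ᵣ} {mass (tgt d)} r r′

      G-onto : ∀ e → ∃[ d ] G d e
      G-onto (transition {inj₁ s} (μ₀ , d , ext)) = inj₁ (transition d) , S.refl , refl , ext
      G-onto (transition {inj₂ t} (μ₀ , d , ext)) = inj₂ (transition d) , S.refl , refl , ext

  module Semantics {L : Actions} (A : TransitionSystem L) where
    open Actions L
    open TransitionSystem A
    open Setoid states using (_≈_)
    private module S = Setoid states

    mutual
      data Path : Set where
        start  : State → Path
        extend : (π : Path) (a : Action) (μ : Distr states) → Δ (last π) a μ →
                 (t : State) → Pos (mass μ t) → Path

      last : Path → State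
      last (start s)              = s
      last (extend _ _ _ _ t _) = t

    first : Path → State
    first (start s)              = s
    first (extend π _ _ _ _ _) = first π

    infix 4 _≈ᵖ_

    data _≈ᵖ_ : Rel Path 0ℓ where
      start  : ∀ {s s′} → s ≈ s′ → start s ≈ᵖ start s′
      extend : ∀ {π π′ a a′ μ μ′ d d′ t t′ p p′} →
               π ≈ᵖ π′ → a ≡ a′ → μ ≈ᵈ μ′ → t ≈ t′ →
               extend π a μ d t p ≈ᵖ extend π′ a′ μ′ d′ t′ p′

    paths : Setoid 0ℓ 0ℓ
    paths = record
      { Carrier       = Path
      ; _≈_           = _≈ᵖ_
      ; isEquivalence = record { refl = λ {π} → r π ; sym = s ; trans = t }
      }
      where
      r : ∀ π → π ≈ᵖ π
      r (start _)            = start S.refl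
      r (extend π _ _ _ _ _) = extend (r π) refl (λ _ → ≈ᵣ-refl) S.refl
      s : ∀ {π ρ} → π ≈ᵖ ρ → ρ ≈ᵖ π
      s (start e)        = start (S.sym e)
      s (extend p a m e) = extend (s p) (≡.sym a) (λ x → ≈ᵣ-sym (m x)) (S.sym e)
      t : ∀ {π ρ σ} → π ≈ᵖ ρ → ρ ≈ᵖ σ → π ≈ᵖ σ
      t (start e)        (start e′)           = start (S.trans e e′)
      t (extend p a m e) (extend p′ a′ m′ e′) =
        extend (t p p′) (≡.trans a a′) (λ x → ≈ᵣ-trans (m x) (m′ x)) (S.trans e e′)

    transitions : Setoid 0ℓ 0ℓ
    transitions = TransitionSetoid L states Δ

    -- nothing stands for ⊥ (stopping).
    choices : Setoid 0ℓ 0ℓ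
    choices = MaybeP.setoid transitions

    record Scheduler : Set where
      field
        choose      : Path → Distr choices
        choose-cong : ∀ {π ρ} → π ≈ᵖ ρ → choose π ≈ᵈ choose ρ
        legal       : ∀ π d → Pos (mass (choose π) (just d)) → src d ≈ last π

    module _ (𝒮 : Scheduler) where
      open Scheduler 𝒮

      stop : Path → ℝ≥0∞
      stop π = mass (choose π) nothing

      take : (π : Path) {a : Action} {μ : Distr states} → Δ (last π) a μ → ℝ≥0∞
      take π d = mass (choose π) (just (transition d))

      -- The probability of a path from its own first state.
      prob : Path → ℝ≥0∞
      prob (start _)            = 1ᵣ
      prob (extend π a μ d t _) = prob π *ᵣ take π d *ᵣ mass μ t

      Scheduled : Path → Set
      Scheduled (start _)            = ⊤
      Scheduled (extend π _ _ d _ _) = Scheduled π × Pos (take π d)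

      Maximal : State → Path → Set
      Maximal s π = first π ≈ s × Scheduled π × Pos (stop π)

      final : State → State → ℝ≥0∞
      final s s′ = ∑ paths (λ π → Maximal s π × last π ≈ s′) (λ π → prob π *ᵣ stop π)

    -- Silent constrains the steps before the last one, hence the states
    -- s₁, …, sₙ₋₁ of a path with n steps; sₙ is unconstrained.
    Silent : Rel State 0ℓ → State → Path → Set
    Silent R s (start _)            = ⊤
    Silent R s (extend π a _ _ t _) = Silent R s π × a ≡ τ × R s t

    Branching : Rel State 0ℓ → State → Action → Path → Set
    Branching R s a (start _)            = ⊥
    Branching R s a (extend π b _ _ _ _) = Silent R s π × b ≡ a

    infix 4 _⇒[_,_]_

    _⇒[_,_]_ : State → Action → Rel State 0ℓ → Distr states → Set
    s ⇒[ a , R ] μ =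
      (a ≡ τ × μ ≈ᵈ 𝟙 s) ⊎
      (Σ[ 𝒮 ∈ Scheduler ] (∀ s′ → final 𝒮 s s′ ≈ᵣ mass μ s′) ×
                          (∀ π → Maximal 𝒮 s π → Branching R s a π))

    record IsBranchingBisimulation (R : Rel State 0ℓ) : Set where
      field
        equivalence : Equivalence states R
        transfer    : ∀ {s t} → R s t → ∀ {a μ} → Δ s a μ →
                      ∃[ μ′ ] t ⇒[ a , R ] μ′ × μ ≡[ R ] μ′

    BisimilarStates : State → State → Set₁
    BisimilarStates p q = ∃[ R ] IsBranchingBisimulation R × R p q

  Bisimilar : {L : Actions} → PA L → PA L → Set₁
  Bisimilar A B = BisimilarStates (inj₁ (init A)) (inj₂ (init B))
    where
    open PA using (system; init)
    open Semantics (system A ⊎ᵗ system B)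

  module _ {L : Actions} (A : PA L) where
    open Actions L
    open PA A
    open Setoid states using (_≈_)

    record TransitionSet : Set₁ where
      field
        member : State → Action → Distr states → Set
        resp   : ∀ {s s′ a μ μ′} → s ≈ s′ → μ ≈ᵈ μ′ → member s a μ → member s′ a μ′

    open TransitionSet

    DeterministicTau : TransitionSet → Set
    DeterministicTau c = ∀ {s a μ} → member c s a μ →
                         Δ s a μ × a ≡ τ × ∃[ t ] μ ≈ᵈ 𝟙 t

    module _ (c : TransitionSet) where

      infix 4 _→c_ _→≈_ _↠c_ _↔*_

      _→c_ : Rel State 0ℓ
      s →c t = member c s τ (𝟙 t)

      -- Steps s ≈ t make sequences of steps insensitive to the choice of
      -- representatives; in particular the empty path connects equal states.
      _→≈_ : Rel State 0ℓ
      s →≈ t = s ≈ t ⊎ s →c t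

      _↠c_ : Rel State 0ℓ
      _↠c_ = Star _→≈_

      _↔*_ : Rel State 0ℓ
      _↔*_ = EqClosure _→≈_

      ↔*-equivalence : Equivalence states _↔*_
      ↔*-equivalence = record
        { isEquivalence = EqC.isEquivalence _→≈_
        ; contains-≈    = λ p → EqC.return (inj₁ p)
        }

      Rc : Rel State 0ℓ
      Rc s s′ = ∃[ u ] s ↠c u × s′ ↠c u

      record WeaklyConfluent : Set where
        field
          equivalence : Equivalence states Rc
          confluent   : ∀ {s t} → s ↠c t → ∀ {a μ} → Δ s a μ →
            ∃[ t′ ] t ↠c t′ ×
              ((∃[ ν ] Δ t′ a ν × μ ≡[ Rc ] ν) ⊎ (a ≡ τ × μ ≡[ Rc ] 𝟙 t′))

module Submission where

-- Since R_c is an equivalence, it coincides with ↔*.  On the disjoint union of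
-- the quotient and A, relate states whose underlying states of A are connected
-- by ↔*.  Every transition of the union comes from a transition s → ν of A, and
-- lumping or embedding ν (both push it forward along a map of states) preserves
-- its values on the classes.  A class related to s makes such a step directly.  A
-- state t of A related to s has a common c-descendant u with s; confluence yields
-- a c-path t ↠ u ↠ t′ inside the class of t such that t′ → ν′ with ν′ equivalent
-- to ν, or else ν is equivalent to 𝟙 t and t can stay put.  The scheduler that
-- runs along this path and then takes t′ → ν′ has final distribution ν′, because
-- every step but the last is deterministic.

open import Axiom.ExcludedMiddle using (ExcludedMiddle)
open import Level using (0ℓ)
open import Data.List.Base using (List; []; _∷_; _++_; filter)
open import Data.List.Relation.Unary.All as All using (All; []; _∷_)
open import Data.List.Relation.Unary.All.Properties as All using (¬Any⇒All¬; all-filter)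
open import Data.List.Relation.Unary.AllPairs using ([]; _∷_)
open import Data.List.Relation.Unary.Any as Any using (Any; here; there)
import Data.List.Relation.Unary.AllPairs.Properties as AllPairs
import Data.List.Relation.Unary.Unique.Setoid as Uniqueness
open import Data.Maybe.Base using (Maybe; just; nothing)
import Data.Maybe.Relation.Binary.Pointwise as Maybe
open import Data.Nat.Base using (ℕ; suc; _≤_; _<_; s≤s)
import Data.Nat.Properties as ℕₚ
open import Data.Product.Base using (∃-syntax; _×_; _,_; proj₁; proj₂)
open import Data.Rational.Base as ℚ using (ℚ; 0ℚ; 1ℚ)
import Data.Rational.Properties as ℚₚ
open import Data.Sum.Base using (_⊎_; inj₁; inj₂)
open import Data.Sum.Relation.Binary.Pointwise using (inj₁; inj₂)
open import Data.Unit.Base using (⊤; tt)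
open import Function.Base using (_∘_; id)
open import Relation.Binary.Bundles using (Setoid)
open import Relation.Binary.Construct.Closure.Equivalence as EqC
open import Relation.Binary.Construct.Closure.ReflexiveTransitive as Star using (ε; _◅_; _◅◅_)
open import Relation.Binary.Construct.Closure.Symmetric using (fwd)
open import Relation.Binary.Core using (Rel)
open import Relation.Binary.PropositionalEquality as ≡ using (_≡_; refl)
open import Relation.Nullary.Decidable using (¬?)
open import Relation.Nullary using (Dec; yes; no; ¬_; contradiction)
open import Defs

module Proof (em : ExcludedMiddle 0ℓ) where
  open Classical em

  -- Order and arithmetic of extended nonnegative reals.

  infix 4 _≤ᵣ_

  record _≤ᵣ_ (x y : ℝ≥0∞) : Set where
    constructor mk≤ᵣ
    field
      up : ∀ {q} → x ∋ q → y ∋ q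

  open _≤ᵣ_

  ≤ᵣ-refl : ∀ {x} → x ≤ᵣ x
  ≤ᵣ-refl = mk≤ᵣ id

  ≤ᵣ-trans : ∀ {x y z} → x ≤ᵣ y → y ≤ᵣ z → x ≤ᵣ z
  ≤ᵣ-trans e f = mk≤ᵣ (up f ∘ up e)

  ≤ᵣ-antisym : ∀ {x y} → x ≤ᵣ y → y ≤ᵣ x → x ≈ᵣ y
  ≤ᵣ-antisym e f = mk≈ᵣ (up e) (up f)

  ≤ᵣ-reflexive : ∀ {x y} → x ≈ᵣ y → x ≤ᵣ y
  ≤ᵣ-reflexive e = mk≤ᵣ (to e)

  0ᵣ≤ : ∀ {x} → 0ᵣ ≤ᵣ x
  0ᵣ≤ {x} = mk≤ᵣ (negative x ∘ 0ᵣ-elim)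

  +ᵣ-mono : ∀ {x x′ y y′} → x ≤ᵣ x′ → y ≤ᵣ y′ → x +ᵣ y ≤ᵣ x′ +ᵣ y′
  +ᵣ-mono e f = mk≤ᵣ λ h →
    let a , b , ha , hb , le = +ᵣ-elim h in +ᵣ-intro (a , b , up e ha , up f hb , le)

  +ᵣ-comm : ∀ {x y} → x +ᵣ y ≤ᵣ y +ᵣ x
  +ᵣ-comm = mk≤ᵣ λ h →
    let a , b , ha , hb , le = +ᵣ-elim h
    in +ᵣ-intro (b , a , hb , ha , ℚₚ.≤-trans le (ℚₚ.≤-reflexive (ℚₚ.+-comm a b)))

  +ᵣ-assoc : ∀ {x y z} → (x +ᵣ y) +ᵣ z ≤ᵣ x +ᵣ (y +ᵣ z)
  +ᵣ-assoc = mk≤ᵣ λ h →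
    let p , c , hp , hc , le  = +ᵣ-elim h
        a , b , ha , hb , le′ = +ᵣ-elim hp
    in +ᵣ-intro (a , b ℚ.+ c , ha , +ᵣ-intro (b , c , hb , hc , ℚₚ.≤-refl) ,
                 ℚₚ.≤-trans le (ℚₚ.≤-trans (ℚₚ.+-monoˡ-≤ c le′) (ℚₚ.≤-reflexive (ℚₚ.+-assoc a b c))))

  +ᵣ-assoc′ : ∀ {x y z} → x +ᵣ (y +ᵣ z) ≤ᵣ (x +ᵣ y) +ᵣ z
  +ᵣ-assoc′ = mk≤ᵣ λ h →
    let a , p , ha , hp , le  = +ᵣ-elim h
        b , c , hb , hc , le′ = +ᵣ-elim hp
    in +ᵣ-intro (a ℚ.+ b , c , +ᵣ-intro (a , b , ha , hb , ℚₚ.≤-refl) , hc ,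
                 ℚₚ.≤-trans le (ℚₚ.≤-trans (ℚₚ.+-monoʳ-≤ a le′) (ℚₚ.≤-reflexive (≡.sym (ℚₚ.+-assoc a b c)))))

  +ᵣ-identityʳ : ∀ {x} → x +ᵣ 0ᵣ ≈ᵣ x
  +ᵣ-identityʳ {x} = mk≈ᵣ drop pad
    where
    drop : ∀ {q} → x +ᵣ 0ᵣ ∋ q → x ∋ q
    drop h =
      let a , b , ha , hb , le = +ᵣ-elim h
      in lower x (ℚₚ.≤-trans le (ℚₚ.≤-trans (ℚₚ.+-monoʳ-≤ a (ℚₚ.<⇒≤ (0ᵣ-elim hb)))
                                             (ℚₚ.≤-reflexive (ℚₚ.+-identityʳ a)))) ha
    pad : ∀ {q} → x ∋ q → x +ᵣ 0ᵣ ∋ q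
    pad {q} h =
      let r , q<r , xr = rounded x h
      -- `0ᵣ` holds only negative rationals, so `q` itself cannot be the first summand; the larger
      -- `r` in `x` leaves the negative remainder `q - r`.
      in +ᵣ-intro (r , q ℚ.- r , xr
                  , 0ᵣ-intro (≡.subst (q ℚ.- r ℚ.<_) (ℚₚ.+-inverseʳ r) (ℚₚ.+-monoˡ-< (ℚ.- r) q<r))
                  , ℚₚ.≤-reflexive (≡.sym (cancel r)))
      where
      open ≡.≡-Reasoning
      cancel : ∀ r → r ℚ.+ (q ℚ.- r) ≡ q
      cancel r = begin
        r ℚ.+ (q ℚ.- r)       ≡⟨ ℚₚ.+-comm r (q ℚ.- r) ⟩
        q ℚ.- r ℚ.+ r         ≡⟨ ℚₚ.+-assoc q (ℚ.- r) r ⟩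
        q ℚ.+ (ℚ.- r ℚ.+ r)   ≡⟨ ≡.cong (q ℚ.+_) (ℚₚ.+-inverseˡ r) ⟩
        q ℚ.+ 0ℚ              ≡⟨ ℚₚ.+-identityʳ q ⟩
        q                     ∎

  *ᵣ-mono : ∀ {x x′ y y′} → x ≤ᵣ x′ → y ≤ᵣ y′ → x *ᵣ y ≤ᵣ x′ *ᵣ y′
  *ᵣ-mono {x} {x′} {y} {y′} e f = mk≤ᵣ λ h → go (*ᵣ-elim h)
    where
    go : ∀ {q} → _ → x′ *ᵣ y′ ∋ q
    go (inj₁ q<0)                                  = *ᵣ-intro (inj₁ q<0)
    go (inj₂ (a , b , 0≤a , 0≤b , ha , hb , le)) =
      *ᵣ-intro (inj₂ (a , b , 0≤a , 0≤b , up e ha , up f hb , le))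

  *ᵣ-cong : ∀ {x x′ y y′} → x ≈ᵣ x′ → y ≈ᵣ y′ → x *ᵣ y ≈ᵣ x′ *ᵣ y′
  *ᵣ-cong e f = ≤ᵣ-antisym (*ᵣ-mono (≤ᵣ-reflexive e) (≤ᵣ-reflexive f))
                           (*ᵣ-mono (≤ᵣ-reflexive (≈ᵣ-sym e)) (≤ᵣ-reflexive (≈ᵣ-sym f)))

  *ᵣ-comm : ∀ {x y} → x *ᵣ y ≤ᵣ y *ᵣ x
  *ᵣ-comm {x} {y} = mk≤ᵣ λ h → go (*ᵣ-elim h)
    where
    go : ∀ {q} → _ → y *ᵣ x ∋ q
    go (inj₁ q<0)                                = *ᵣ-intro (inj₁ q<0)
    go (inj₂ (a , b , 0≤a , 0≤b , ha , hb , le)) =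
      *ᵣ-intro (inj₂ (b , a , 0≤b , 0≤a , hb , ha , ℚₚ.≤-trans le (ℚₚ.≤-reflexive (ℚₚ.*-comm a b))))

  *ᵣ-identityʳ : ∀ {x} → x *ᵣ 1ᵣ ≈ᵣ x
  *ᵣ-identityʳ {x} = mk≈ᵣ (λ h → shrink (*ᵣ-elim h)) grow
    where
    shrink : ∀ {q} → _ → x ∋ q
    shrink (inj₁ q<0)                                = negative x q<0
    shrink (inj₂ (a , b , 0≤a , 0≤b , ha , hb , le)) =
      lower x (ℚₚ.≤-trans le (ℚₚ.≤-trans
                (ℚₚ.*-monoˡ-≤-nonNeg a {{ℚ.nonNegative 0≤a}} (ℚₚ.<⇒≤ (1ᵣ-elim hb)))
                (ℚₚ.≤-reflexive (ℚₚ.*-identityʳ a)))) ha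

    -- For 0 ≤ q < r in x, the factorisation q = r · (q / r) has q / r < 1.
    scale : ∀ {q r} → 0ℚ ℚ.≤ q → q ℚ.< r → x ∋ r → x *ᵣ 1ᵣ ∋ q
    scale {q} {r} 0≤q q<r xr = *ᵣ-intro (inj₂
      ( r , q ℚ.* ℚ.1/ r , ℚₚ.<⇒≤ 0<r
      , ≡.subst (ℚ._≤ q ℚ.* ℚ.1/ r) (ℚₚ.*-zeroˡ (ℚ.1/ r))
          (ℚₚ.*-monoʳ-≤-nonNeg (ℚ.1/ r) {{ℚₚ.pos⇒nonNeg (ℚ.1/ r)}} 0≤q)
      , xr
      , 1ᵣ-intro (≡.subst (q ℚ.* ℚ.1/ r ℚ.<_) (ℚₚ.*-inverseʳ r) (ℚₚ.*-monoˡ-<-pos (ℚ.1/ r) q<r))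
      , ℚₚ.≤-reflexive (≡.sym cancel)))
      where
      0<r = ℚₚ.≤-<-trans 0≤q q<r
      instance
        r>0 : ℚ.Positive r
        r>0 = ℚ.positive 0<r
        r≢0 : ℚ.NonZero r
        r≢0 = ℚₚ.pos⇒nonZero r
        1/r>0 : ℚ.Positive (ℚ.1/ r)
        1/r>0 = ℚₚ.1/pos⇒pos r
      open ≡.≡-Reasoning
      cancel : r ℚ.* (q ℚ.* ℚ.1/ r) ≡ q
      cancel = begin
        r ℚ.* (q ℚ.* ℚ.1/ r)   ≡⟨ ℚₚ.*-comm r (q ℚ.* ℚ.1/ r) ⟩
        q ℚ.* ℚ.1/ r ℚ.* r     ≡⟨ ℚₚ.*-assoc q (ℚ.1/ r) r ⟩
        q ℚ.* (ℚ.1/ r ℚ.* r)   ≡⟨ ≡.cong (q ℚ.*_) (ℚₚ.*-inverseˡ r) ⟩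
        q ℚ.* 1ℚ               ≡⟨ ℚₚ.*-identityʳ q ⟩
        q                      ∎

    grow : ∀ {q} → x ∋ q → x *ᵣ 1ᵣ ∋ q
    grow {q} h with q ℚₚ.<? 0ℚ
    ... | yes q<0 = *ᵣ-intro (inj₁ q<0)
    ... | no  q≮0 = let r , q<r , xr = rounded x h in scale (ℚₚ.≮⇒≥ q≮0) q<r xr

  *ᵣ-identityˡ : ∀ {x} → 1ᵣ *ᵣ x ≈ᵣ x
  *ᵣ-identityˡ = ≈ᵣ-trans (≤ᵣ-antisym *ᵣ-comm *ᵣ-comm) *ᵣ-identityʳ

  ≤0ᵣ⇒≈0ᵣ : ∀ {x} → x ≤ᵣ 0ᵣ → x ≈ᵣ 0ᵣ
  ≤0ᵣ⇒≈0ᵣ le = ≤ᵣ-antisym le 0ᵣ≤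

  -- Negative rationals lie in every cut, and a nonnegative one in `x` puts `0ℚ` into `x`. This is
  -- for bounds witnessed by a path that exists only where the mass is positive.
  ≤ᵣ-if-Pos : ∀ {x y} → (Pos x → x ≤ᵣ y) → x ≤ᵣ y
  ≤ᵣ-if-Pos {x} {y} f = mk≤ᵣ go
    where
    go : ∀ {q} → x ∋ q → y ∋ q
    go {q} h with q ℚₚ.<? 0ℚ
    ... | yes q<0 = negative y q<0
    ... | no  q≮0 = up (f (lower x (ℚₚ.≮⇒≥ q≮0) h)) h

  Pos-1ᵣ : Pos 1ᵣ
  Pos-1ᵣ = 1ᵣ-intro (ℚₚ.positive⁻¹ 1ℚ)

  ¬Pos-0ᵣ : ¬ Pos 0ᵣ
  ¬Pos-0ᵣ h = ℚₚ.<-irrefl refl (0ᵣ-elim h)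

  χ-cong : ∀ {P Q : Set} → (P → Q) → (Q → P) → χ P ≈ᵣ χ Q
  χ-cong {P} f g with em {P}
  ... | yes p = ≈ᵣ-trans (χ-yes p) (≈ᵣ-sym (χ-yes (f p)))
  ... | no ¬p = ≈ᵣ-trans (χ-no ¬p) (≈ᵣ-sym (χ-no (¬p ∘ g)))

  Pos-χ⇒ : ∀ {P : Set} → Pos (χ P) → P
  Pos-χ⇒ {P} h with em {P}
  ... | yes p = p
  ... | no ¬p = contradiction (to (χ-no ¬p) h) ¬Pos-0ᵣ

  -- Finite sums, infinite sums and point masses.

  sumList-++ : {A : Set} {f : A → ℝ≥0∞} (xs ys : List A) →
               sumList f xs +ᵣ sumList f ys ≤ᵣ sumList f (xs ++ ys)
  sumList-++ []       ys = ≤ᵣ-trans +ᵣ-comm (≤ᵣ-reflexive +ᵣ-identityʳ)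
  sumList-++ (x ∷ xs) ys = ≤ᵣ-trans +ᵣ-assoc (+ᵣ-mono ≤ᵣ-refl (sumList-++ xs ys))

  sumList-partition : {A : Set} {f : A → ℝ≥0∞} {P : A → Set} (P? : ∀ x → Dec (P x)) (xs : List A) →
                      sumList f xs ≤ᵣ sumList f (filter P? xs) +ᵣ sumList f (filter (¬? ∘ P?) xs)
  sumList-partition P? []       = ≤ᵣ-reflexive (≈ᵣ-sym +ᵣ-identityʳ)
  sumList-partition {f = f} P? (x ∷ xs) with P? x
  ... | yes _ = ≤ᵣ-trans (+ᵣ-mono ≤ᵣ-refl (sumList-partition P? xs)) +ᵣ-assoc′
  ... | no  _ = ≤ᵣ-trans (+ᵣ-mono (≤ᵣ-refl {f x}) (sumList-partition P? xs))
                  (≤ᵣ-trans +ᵣ-comm (≤ᵣ-trans +ᵣ-assoc (+ᵣ-mono ≤ᵣ-refl +ᵣ-comm)))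

  module _ {X : Setoid 0ℓ 0ℓ} where
    open Setoid X using (Carrier; _≈_)

    ∑-cong : ∀ {P Q : Carrier → Set} {f g : Carrier → ℝ≥0∞} →
             (∀ {x} → P x → Q x) → (∀ {x} → Q x → P x) → (∀ x → f x ≈ᵣ g x) →
             ∑ X P f ≈ᵣ ∑ X Q g
    ∑-cong PQ QP e = mk≈ᵣ
      (λ h → let xs , u , ps , s = ∑-elim h in ∑-intro (xs , u , All.map PQ ps , sumList-cong e xs s))
      (λ h → let xs , u , ps , s = ∑-elim h in
             ∑-intro (xs , u , All.map QP ps , sumList-cong (≈ᵣ-sym ∘ e) xs s))

    ∑-zero : ∀ {P : Carrier → Set} {f : Carrier → ℝ≥0∞} →
             (∀ {x} → P x → f x ≤ᵣ 0ᵣ) → ∑ X P f ≈ᵣ 0ᵣ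
    ∑-zero {P} {f} z = ≤0ᵣ⇒≈0ᵣ (mk≤ᵣ λ h → let xs , _ , ps , s = ∑-elim h in up (go ps) s)
      where
      go : ∀ {xs} → All P xs → sumList f xs ≤ᵣ 0ᵣ
      go []       = ≤ᵣ-refl
      go (p ∷ ps) = ≤ᵣ-trans (+ᵣ-mono (z p) (go ps)) (≤ᵣ-reflexive +ᵣ-identityʳ)

    ∑-≥ : ∀ {P : Carrier → Set} {f : Carrier → ℝ≥0∞} {x} → P x → f x ≤ᵣ ∑ X P f
    ∑-≥ {x = x} p = mk≤ᵣ λ h → ∑-intro (x ∷ [] , [] ∷ [] , p ∷ [] , from +ᵣ-identityʳ h)

    -- A duplicate-free list of elements of `P` has at most one entry.
    ∑-≤-point : ∀ {P : Carrier → Set} {f : Carrier → ℝ≥0∞} {v} →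
                (∀ {x y} → P x → P y → x ≈ y) → (∀ {x} → P x → f x ≤ᵣ v) → ∑ X P f ≤ᵣ v
    ∑-≤-point {P} {f} {v} sub le = mk≤ᵣ λ h → let xs , u , ps , s = ∑-elim h in up (go u ps) s
      where
      open Uniqueness X using (Unique)
      go : ∀ {xs} → Unique xs → All P xs → sumList f xs ≤ᵣ v
      go _                   []           = 0ᵣ≤
      go _                   (p ∷ [])     = ≤ᵣ-trans (≤ᵣ-reflexive +ᵣ-identityʳ) (le p)
      go ((x≉y ∷ _) ∷ _)     (p ∷ p′ ∷ _) = contradiction (sub p p′) x≉y

    -- The total mass bounds the value from above, the single point `t` from below.
    𝟙-∈ : ∀ {t} {P : Carrier → Set} → P t → 𝟙 {X} t ⟨ P ⟩ ≈ᵣ 1ᵣ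
    𝟙-∈ {t} p = ≤ᵣ-antisym
      (mk≤ᵣ λ h → let xs , u , ps , s = ∑-elim h
                  in to (total (𝟙 {X} t)) (∑-intro (xs , u , All.map (λ _ → tt) ps , s)))
      (≤ᵣ-trans (≤ᵣ-reflexive (≈ᵣ-sym (χ-yes (Setoid.refl X)))) (∑-≥ p))

    𝟙-∉ : ∀ {t} {P : Carrier → Set} → (∀ {x} → x ≈ t → P x → P t) → ¬ P t → 𝟙 {X} t ⟨ P ⟩ ≈ᵣ 0ᵣ
    𝟙-∉ resp ¬p = ∑-zero λ p → ≤ᵣ-reflexive (χ-no λ x≈t → ¬p (resp x≈t p))

  -- Images of distributions under maps.

  module _ {X Y : Setoid 0ℓ 0ℓ} where
    private
      module X = Setoid X
      module Y = Setoid Y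
      module UX = Uniqueness X
      module UY = Uniqueness Y

    module _ {i : X.Carrier → Y.Carrier} (i-cong : ∀ {x x′} → x X.≈ x′ → i x Y.≈ i x′) where

      private
        Meets : List Y.Carrier → X.Carrier → Set
        Meets ys x = Any (Y._≈ i x) ys

        apart : ∀ {y ys x x′} → All (y Y.≉_) ys → y Y.≈ i x → Meets ys x′ → x X.≉ x′
        apart (y≉z ∷ _) y≈ix (here z≈ix′) x≈x′ =
          y≉z (Y.trans y≈ix (Y.trans (i-cong x≈x′) (Y.sym z≈ix′)))
        apart (_ ∷ n)   y≈ix (there m)    x≈x′ = apart n y≈ix m x≈x′

        module _ (f : X.Carrier → ℝ≥0∞) where

          fibre : Y.Carrier → ℝ≥0∞
          fibre y = ∑ X (λ x → y Y.≈ i x) f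

          -- Partial sums for the fibres over `ys` are concatenated. Fibres over distinct points are
          -- disjoint (`apart`), so the result is again duplicate-free.
          collect : ∀ {ys} → UY.Unique ys → ∀ {q} → sumList fibre ys ∋ q →
                    ∃[ xs ] UX.Unique xs × All (Meets ys) xs × sumList f xs ∋ q
          collect []               h = [] , [] , [] , h
          collect {y ∷ ys} (n ∷ u) h =
            let a , b , ha , hb , le = +ᵣ-elim h
                xs  , v  , ms  , s   = ∑-elim ha
                xs′ , v′ , ms′ , s′  = collect u hb
            in xs ++ xs′
             , AllPairs.++⁺ v v′ (All.map (λ e → All.map (apart n e) ms′) ms)
             , All.++⁺ (All.map here ms) (All.map there ms′)
             , up (sumList-++ xs xs′) (+ᵣ-intro (a , b , s , s′ , le))

          -- Induction on `ys`: the entries of `xs` over `y` form one partial sum of its fibre, and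
          -- the others all lie over the remaining points.
          distribute : ∀ ys {xs} → UX.Unique xs → All (Meets ys) xs →
                       sumList f xs ≤ᵣ sumList fibre ys
          distribute []       _ []       = ≤ᵣ-refl
          distribute []       _ (() ∷ _)
          distribute (y ∷ ys) {xs} u ms  =
            ≤ᵣ-trans (sumList-partition on? xs)
              (+ᵣ-mono (mk≤ᵣ λ h → ∑-intro (_ , AllPairs.filter⁺ on? u , all-filter on? xs , h))
                       (distribute ys (AllPairs.filter⁺ (¬? ∘ on?) u)
                          (All.zipWith (λ (m , ¬e) → Any.tail ¬e m)
                             (All.filter⁺ (¬? ∘ on?) ms , all-filter (¬? ∘ on?) xs))))
            where
            on? : ∀ x → Dec (y Y.≈ i x)
            on? x = em

          -- Different entries of `xs` may have equal images, so an image is added only if the list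
          -- does not contain it yet.
          representatives : ∀ {P : Y.Carrier → Set} xs → All (P ∘ i) xs →
                            ∃[ ys ] UY.Unique ys × All P ys × All (Meets ys) xs
          representatives []       []       = [] , [] , [] , []
          representatives (x ∷ xs) (p ∷ ps) with representatives xs ps
          ... | ys , u , qs , ms with em {Meets ys x}
          ...   | yes m = ys , u , qs , m ∷ ms
          ...   | no ¬m = i x ∷ ys , All.map (λ y≉ix → y≉ix ∘ Y.sym) (¬Any⇒All¬ ys ¬m) ∷ u
                        , p ∷ qs , here Y.refl ∷ All.map there ms

      -- Any rational below a finite partial sum on one side is below one on the other: by `collect`
      -- from left to right, by `distribute` for the converse.
      ∑-fibres : ∀ {P : Y.Carrier → Set} {f : X.Carrier → ℝ≥0∞} →
                 (∀ {y y′} → y Y.≈ y′ → P y → P y′) →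
                 ∑ Y P (λ y → ∑ X (λ x → y Y.≈ i x) f) ≈ᵣ ∑ X (P ∘ i) f
      ∑-fibres {P} {f} resp = mk≈ᵣ
        (λ h → let ys , u , ps , s  = ∑-elim h
                   xs , v , ms , s′ = collect f u s
               in ∑-intro (xs , v , All.map (λ m → within ps m) ms , s′))
        (λ h → let xs , u , ps , s  = ∑-elim h
                   ys , v , qs , ms = representatives f {P} xs ps
               in ∑-intro (ys , v , qs , up (distribute f ys u ms) s))
        where
        within : ∀ {x ys} → All P ys → Meets ys x → P (i x)
        within (p ∷ _)  (here e)  = resp e p
        within (_ ∷ ps) (there m) = within ps m

      -- The image distribution. It serves both for lumping, where `i` is the identity into a
      -- coarser setoid, and for embedding into the union, where `i` is an injection.
      push : Distr X → Distr Y
      push μ = record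
        { mass      = λ y → ∑ X (λ x → y Y.≈ i x) (mass μ)
        ; mass-cong = λ e → ∑-cong (Y.trans (Y.sym e)) (Y.trans e) (λ _ → ≈ᵣ-refl)
        ; total     = ≈ᵣ-trans (∑-fibres _) (total μ)
        }

      push-⟨⟩ : ∀ μ {P : Y.Carrier → Set} → (∀ {y y′} → y Y.≈ y′ → P y → P y′) →
                push μ ⟨ P ⟩ ≈ᵣ μ ⟨ P ∘ i ⟩
      push-⟨⟩ μ = ∑-fibres

  -- Schedulers that follow a fixed path.

  module _ {L : Actions} (T : TransitionSystem L) where
    open Actions L
    open TransitionSystem T
    open Semantics T
    private
      module S = Setoid states
      module C = Setoid choices
      module P = Setoid paths

    len : Path → ℕ
    len (start _)            = 0
    len (extend π _ _ _ _ _) = suc (len π)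

    len-cong : ∀ {π ρ} → π ≈ᵖ ρ → len π ≡ len ρ
    len-cong (start _)        = refl
    len-cong (extend e _ _ _) = ≡.cong suc (len-cong e)

    last-cong : ∀ {π ρ} → π ≈ᵖ ρ → last π S.≈ last ρ
    last-cong (start e)        = e
    last-cong (extend _ _ _ e) = e

    -- Along such a path each next state is certain, so a scheduler that follows it neither loses
    -- probability nor branches off.
    Dirac : Path → Set
    Dirac (start _)            = ⊤
    Dirac (extend π _ μ _ t _) = Dirac π × μ ≈ᵈ 𝟙 t

    module _ (𝒮 : Scheduler) where
      open Scheduler 𝒮

      prob-cong : ∀ {π ρ} → π ≈ᵖ ρ → prob 𝒮 π ≈ᵣ prob 𝒮 ρ
      prob-cong (start _) = ≈ᵣ-refl
      prob-cong {extend π _ μ _ t _} {extend ρ _ _ _ t′ _} (extend e a m t≈t′) =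
        *ᵣ-cong
          (*ᵣ-cong (prob-cong e)
                   (≈ᵣ-trans (mass-cong (choose π) (Maybe.just (last-cong e , a , m))) (choose-cong e _)))
          (≈ᵣ-trans (mass-cong μ t≈t′) (m t′))

    -- Schedulers without randomisation: `f` names the transition to take, or `nothing` to stop.
    -- `f-cong` can demand propositional equality because `next` returns stored transitions that do
    -- not depend on the representative of the path.
    module Deterministic
      (f      : Path → Maybe (Transition L states Δ))
      (f-cong : ∀ {π ρ} → π ≈ᵖ ρ → f π ≡ f ρ)
      (f-src  : ∀ π {e} → f π ≡ just e → src e S.≈ last π)
      where

      chosen : ∀ {π c} → c C.≈ f π → ∀ {e} → c ≡ just e →
               ∃[ e′ ] f π ≡ just e′ × src e S.≈ src e′ × act e ≡ act e′ × tgt e ≈ᵈ tgt e′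
      chosen {π} c≈fπ refl with f π | c≈fπ
      ... | just e′ | Maybe.just eq = e′ , refl , eq

      halted : ∀ {π} → nothing C.≈ f π → f π ≡ nothing
      halted {π} n≈fπ with f π | n≈fπ
      ... | nothing | Maybe.nothing = refl

      scheduler : Scheduler
      scheduler = record
        { choose      = λ π → 𝟙 (f π)
        ; choose-cong = λ {π} e → ≡.subst (λ c → 𝟙 {choices} (f π) ≈ᵈ 𝟙 c) (f-cong e) (λ _ → ≈ᵣ-refl)
        ; legal       = λ π d h → let e , fπ≡e , s≈ , _ = chosen (Pos-χ⇒ h) refl
                                  in S.trans s≈ (f-src π fπ≡e)
        }

      Follows : Path → Set
      Follows (start _)            = ⊤
      Follows (extend π _ _ d _ _) = Follows π × f π ≡ just (transition d)

      take-1 : ∀ π {a μ} (d : Δ (last π) a μ) → f π ≡ just (transition d) → take scheduler π d ≈ᵣ 1ᵣ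
      take-1 π d e = χ-yes (C.reflexive (≡.sym e))

      stop-1 : ∀ π → f π ≡ nothing → stop scheduler π ≈ᵣ 1ᵣ
      stop-1 π e = χ-yes (C.reflexive (≡.sym e))

      scheduled : ∀ π → Follows π → Scheduled scheduler π
      scheduled (start _)            _        = tt
      scheduled (extend π _ _ d _ _) (fo , e) = scheduled π fo , from (take-1 π d e) Pos-1ᵣ

      -- Every factor before the last mass is 1: `f` chooses each step with certainty, and each
      -- earlier distribution is a point mass at the state visited.
      prob-extend : ∀ {π a μ d t p} → Dirac π → Follows (extend π a μ d t p) →
                    prob scheduler (extend π a μ d t p) ≈ᵣ mass μ t
      prob-Dirac : ∀ π → Dirac π → Follows π → prob scheduler π ≈ᵣ 1ᵣ

      prob-extend {π} {d = d} δ (fo , e) =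
        ≈ᵣ-trans (*ᵣ-cong (*ᵣ-cong (prob-Dirac π δ fo) (take-1 π d e)) ≈ᵣ-refl)
          (≈ᵣ-trans (*ᵣ-cong *ᵣ-identityˡ ≈ᵣ-refl) *ᵣ-identityˡ)

      prob-Dirac (start _)            _        _  = ≈ᵣ-refl
      prob-Dirac (extend π _ μ _ t p) (δ , μ≈) fo =
        ≈ᵣ-trans (prob-extend {p = p} δ fo) (≈ᵣ-trans (μ≈ t) (χ-yes S.refl))

    -- Steps of c may form cycles, so the position is read off the whole path and not its last state.
    mutual
      next : ∀ ρ {a μ} → Δ (last ρ) a μ → Path → Maybe (Transition L states Δ)
      next ρ d π with em {π ≈ᵖ ρ}
      ... | yes _ = just (transition d)
      ... | no  _ = earlier ρ π

      earlier : Path → Path → Maybe (Transition L states Δ)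
      earlier (start _)            π = nothing
      earlier (extend ρ _ _ d _ _) π = next ρ d π

    next-here : ∀ {ρ a μ} {d : Δ (last ρ) a μ} {π} → π ≈ᵖ ρ → next ρ d π ≡ just (transition d)
    next-here {ρ} {π = π} e with em {π ≈ᵖ ρ}
    ... | yes _ = refl
    ... | no ¬e = contradiction e ¬e

    next-there : ∀ {ρ a μ} {d : Δ (last ρ) a μ} {π} → ¬ π ≈ᵖ ρ → next ρ d π ≡ earlier ρ π
    next-there {ρ} {π = π} ¬e with em {π ≈ᵖ ρ}
    ... | yes e = contradiction e ¬e
    ... | no _  = refl

    mutual
      next-cong : ∀ ρ {a μ} (d : Δ (last ρ) a μ) {π π′} → π ≈ᵖ π′ → next ρ d π ≡ next ρ d π′
      next-cong ρ d {π} {π′} e with em {π ≈ᵖ ρ}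
      ... | yes e′ = ≡.sym (next-here (P.trans (P.sym e) e′))
      ... | no ¬e′ = ≡.trans (earlier-cong ρ e) (≡.sym (next-there (¬e′ ∘ P.trans e)))

      earlier-cong : ∀ ρ {π π′} → π ≈ᵖ π′ → earlier ρ π ≡ earlier ρ π′
      earlier-cong (start _)            e = refl
      earlier-cong (extend ρ _ _ d _ _) e = next-cong ρ d e

    mutual
      next-src : ∀ ρ {a μ} (d : Δ (last ρ) a μ) π {e} → next ρ d π ≡ just e → src e S.≈ last π
      next-src ρ d π eq with em {π ≈ᵖ ρ} | eq
      ... | yes e | refl = S.sym (last-cong e)
      ... | no _  | eq′  = earlier-src ρ π eq′

      earlier-src : ∀ ρ π {e} → earlier ρ π ≡ just e → src e S.≈ last π
      earlier-src (extend ρ _ _ d _ _) π eq = next-src ρ d π eq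

    mutual
      -- `earlier` answers only at proper prefixes of `ρ`, up to equality of paths, and equality
      -- preserves length. So the scheduler stops once the path is longer than `ρ`.
      next-len : ∀ ρ {a μ} (d : Δ (last ρ) a μ) {π e} → next ρ d π ≡ just e → len π ≤ len ρ
      next-len ρ d {π} eq with em {π ≈ᵖ ρ} | eq
      ... | yes e | _   = ℕₚ.≤-reflexive (len-cong e)
      ... | no _  | eq′ = ℕₚ.<⇒≤ (earlier-len ρ eq′)

      earlier-len : ∀ ρ {π e} → earlier ρ π ≡ just e → len π < len ρ
      earlier-len (extend ρ _ _ d _ _) eq = s≤s (next-len ρ d eq)

    module _ (ρ : Path) {a : Action} {μ : Distr states} (d : Δ (last ρ) a μ) where
      open Deterministic (next ρ d) (next-cong ρ d) (next-src ρ d) public using ()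
        renaming (scheduler to along; Follows to Along)

    -- Lengthening the plan adds a choice only at the extended path. The bound lets `π` be as long
    -- as that path, since `Along` consults only the proper prefixes of `π`.
    Along-earlier : ∀ {ρ a μ t p b ν} {d : Δ (last ρ) a μ} {e : Δ t b ν} π →
                    len π ≤ suc (len ρ) → Along ρ d π → Along (extend ρ a μ d t p) e π
    Along-earlier (start _)            _        _        = tt
    Along-earlier (extend π _ _ _ _ _) (s≤s le) (al , e) =
      Along-earlier π (ℕₚ.m≤n⇒m≤1+n le) al ,
      ≡.trans (next-there (λ π≈ → ℕₚ.<⇒≢ (s≤s le) (len-cong π≈))) e

    Along-extend : ∀ ρ {a μ} (d : Δ (last ρ) a μ) {t} (p : Pos (mass μ t)) → Along ρ d (extend ρ a μ d t p)
    Along-extend (start _)            d _ = tt , next-here (start S.refl)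
    Along-extend (extend ρ _ _ e t p) d _ =
      Along-earlier (extend ρ _ _ e t p) ℕₚ.≤-refl (Along-extend ρ e p) , next-here P.refl

    mutual
      -- `start s` is the shortest prefix of `ρ`, so a maximal path cannot stop at once.
      next-start : ∀ ρ {a μ} (d : Δ (last ρ) a μ) {s} → s S.≈ first ρ → ∃[ e ] next ρ d (start s) ≡ just e
      next-start ρ d {s} s≈ with em {start s ≈ᵖ ρ}
      ... | yes _ = _ , refl
      ... | no ¬e = earlier-start ρ s≈ ¬e

      earlier-start : ∀ ρ {s} → s S.≈ first ρ → ¬ start s ≈ᵖ ρ → ∃[ e ] earlier ρ (start s) ≡ just e
      earlier-start (start _)            s≈ ¬e = contradiction (start s≈) ¬e
      earlier-start (extend ρ _ _ d _ _) s≈ _  = next-start ρ d s≈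

    module _ {π : Path} {b : Action} {ν : Distr states} {e : Δ (last π) b ν} {t : State} {p : Pos (mass ν t)} where
      private π⁺ = extend π b ν e t p

      mutual
        -- The step taken at a proper prefix of `ρ` has the label and distribution that `ρ` has
        -- there; as that distribution is a point mass, the extended path is again a prefix of `ρ`.
        -- At `ρ` itself the step is `d`, with no constraint on its outcome.
        next-step : ∀ ρ {a μ} (d : Δ (last ρ) a μ) → Dirac ρ → ∀ {g} →
                    next ρ d π ≡ just g → b ≡ act g → ν ≈ᵈ tgt g →
                    (∃[ g′ ] next ρ d π⁺ ≡ just g′) ⊎ (π ≈ᵖ ρ × b ≡ a × ν ≈ᵈ μ)
        next-step ρ d δ eq b≡ ν≈ with em {π ≈ᵖ ρ} | eq
        ... | yes π≈ρ | refl = inj₂ (π≈ρ , b≡ , ν≈)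
        ... | no _    | eq′  = inj₁ (earlier-step ρ d δ eq′ b≡ ν≈)

        earlier-step : ∀ ρ {a μ} (d : Δ (last ρ) a μ) → Dirac ρ → ∀ {g} →
                       earlier ρ π ≡ just g → b ≡ act g → ν ≈ᵈ tgt g → ∃[ g′ ] next ρ d π⁺ ≡ just g′
        earlier-step ρ@(extend ρ′ _ μ′ d′ t′ _) d (δ , μ′≈) eq b≡ ν≈ with next-step ρ′ d′ δ eq b≡ ν≈
        ... | inj₂ (π≈ρ′ , b≡a′ , ν≈μ′) =
          -- `t` has positive mass under `ν`, which equals the point mass at `t′`; hence `t ≈ t′`.
          _ , next-here (extend π≈ρ′ b≡a′ ν≈μ′ (Pos-χ⇒ (to (≈ᵣ-trans (ν≈μ′ t) (μ′≈ t)) p)))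
        -- Whichever way the test in `next` falls, some transition is returned.
        ... | inj₁ (_ , eq′) with em {π⁺ ≈ᵖ ρ}
        ...   | yes _ = _ , refl
        ...   | no _  = _ , eq′

    module _ (ρ : Path) {a : Action} {μ : Distr states} (d : Δ (last ρ) a μ) (δ : Dirac ρ) where
      open Deterministic (next ρ d) (next-cong ρ d) (next-src ρ d)

      -- Only the last step has to be inspected: the scheduler does not stop at the start, and after
      -- a scheduled step it stops only if that step was `d` taken at `ρ`.
      completed : ∀ π → Maximal scheduler (first ρ) π → ∃[ p ] π ≈ᵖ extend ρ a μ d (last π) p
      completed π (s≈ , sch , h) = go π s≈ sch (halted (Pos-χ⇒ h))
        where
        clash : ∀ {π} {A : Set} → next ρ d π ≡ nothing → ∃[ g ] next ρ d π ≡ just g → A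
        clash n (_ , j) with () ← ≡.trans (≡.sym n) j
        go : ∀ π → first π S.≈ first ρ → Scheduled scheduler π → next ρ d π ≡ nothing →
             ∃[ p ] π ≈ᵖ extend ρ a μ d (last π) p
        go (start s)            s≈ _         n = clash n (next-start ρ d s≈)
        go (extend π b ν e t p) s≈ (_ , pos) n with chosen (Pos-χ⇒ pos) refl
        ... | g , eq , _ , b≡ , ν≈ with next-step ρ d δ eq b≡ ν≈
        ...   | inj₁ on                = clash n on
        ...   | inj₂ (π≈ρ , b≡a , ν≈μ) = to (ν≈μ t) p , extend π≈ρ b≡a ν≈μ S.refl

      after : ∀ {t} (p : Pos (mass μ t)) → next ρ d (extend ρ a μ d t p) ≡ nothing
      after {t} p with next ρ d (extend ρ a μ d t p) in eq
      ... | nothing = refl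
      ... | just _  = contradiction (next-len ρ d eq) (ℕₚ.<⇒≱ ℕₚ.≤-refl)

      complete : ∀ {t} (p : Pos (mass μ t)) → Maximal scheduler (first ρ) (extend ρ a μ d t p)
      complete {t} p = S.refl , scheduled (extend ρ a μ d t p) (Along-extend ρ d p) , from (stop-1 _ (after p)) Pos-1ᵣ

      -- All maximal paths that end in `t` are equal, so the sum has at most one term, of value
      -- `mass μ t`. If that mass is 0 there is no term, whence `≤ᵣ-if-Pos`.
      final-complete : ∀ t → final scheduler (first ρ) t ≈ᵣ mass μ t
      final-complete t = ≤ᵣ-antisym (∑-≤-point {X = paths} single below-μ) (≤ᵣ-if-Pos λ p →
          ≤ᵣ-trans (≤ᵣ-reflexive (≈ᵣ-sym (weight p))) (∑-≥ {X = paths} (complete p , S.refl)))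
        where
        weight : ∀ {t} (p : Pos (mass μ t)) →
                 prob scheduler (extend ρ a μ d t p) *ᵣ stop scheduler (extend ρ a μ d t p) ≈ᵣ mass μ t
        weight p = ≈ᵣ-trans (*ᵣ-cong (prob-extend {p = p} δ (Along-extend ρ d p)) (stop-1 _ (after p))) *ᵣ-identityʳ
        single : ∀ {π π′} → Maximal scheduler (first ρ) π × last π S.≈ t →
                 Maximal scheduler (first ρ) π′ × last π′ S.≈ t → π ≈ᵖ π′
        single (m , e) (m′ , e′) with completed _ m | completed _ m′
        ... | p , c | p′ , c′ =
          P.trans c (P.trans (extend P.refl refl (λ _ → ≈ᵣ-refl) (S.trans e (S.sym e′))) (P.sym c′))
        below-μ : ∀ {π} → Maximal scheduler (first ρ) π × last π S.≈ t →
                  prob scheduler π *ᵣ stop scheduler π ≤ᵣ mass μ t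
        below-μ (m , e) with completed _ m
        ... | p , c = ≤ᵣ-reflexive (≈ᵣ-trans
          (*ᵣ-cong (prob-cong scheduler c) (Scheduler.choose-cong scheduler c nothing))
          (≈ᵣ-trans (weight p) (mass-cong μ e)))

    module _ {R : Rel State 0ℓ} (R-resp : ∀ {s t t′} → t S.≈ t′ → R s t → R s t′) where

      Silent-resp : ∀ {s π ρ} → π ≈ᵖ ρ → Silent R s π → Silent R s ρ
      Silent-resp (start _)           _            = tt
      Silent-resp (extend e refl _ q) (si , b , r) = Silent-resp e si , b , R-resp q r

      Branching-resp : ∀ {s a π ρ} → π ≈ᵖ ρ → Branching R s a π → Branching R s a ρ
      Branching-resp (extend e refl _ _) (si , b) = Silent-resp e si , b

      -- Every maximal path of `along ρ d` is `ρ` followed by `d`, but only up to equality of paths;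
      -- `R-resp` carries the silence of `ρ` over to it.
      run-⇒ : ∀ {s a μ} ρ → first ρ ≡ s → Dirac ρ → Silent R s ρ → Δ (last ρ) a μ → s ⇒[ a , R ] μ
      run-⇒ ρ refl δ si d = inj₂
        ( along ρ d , final-complete ρ d δ
        , λ π m → Branching-resp (P.sym (proj₂ (completed ρ d δ π m))) (si , refl))

  module _ {X Y : Setoid 0ℓ 0ℓ} where
    private
      module X = Setoid X
      module Y = Setoid Y

    -- The fibres of an injective map have at most one point.
    push-at : ∀ {i : X.Carrier → Y.Carrier} (i-cong : ∀ {x x′} → x X.≈ x′ → i x Y.≈ i x′) →
              (∀ {x x′} → i x Y.≈ i x′ → x X.≈ x′) →
              ∀ μ x → mass (push {X} {Y} i-cong μ) (i x) ≈ᵣ mass μ x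
    push-at {i} i-cong i-inj μ x = ≤ᵣ-antisym
      (∑-≤-point (λ e e′ → X.trans (X.sym (i-inj e)) (i-inj e′))
                 (λ e → ≤ᵣ-reflexive (mass-cong μ (X.sym (i-inj e)))))
      (∑-≥ Y.refl)

  -- The bisimulation on the union of the quotient and the automaton.

  module _ {L : Actions} (A : PA L) (c : TransitionSet A)
           (det : DeterministicTau A c) (conf : WeaklyConfluent A c) where
    open Actions L
    open PA A using (states; Δ; Δ-resp; State)

    private
      infix 4 _↠_ _↔_

      _↠_ _↔_ : Rel State 0ℓ
      _↠_ = _↠c_ A c
      _↔_ = _↔*_ A c

      quotient = A / ↔*-equivalence A c
      U = PA.system quotient ⊎ᵗ PA.system A

      module S = Setoid states
      module Q = Setoid (PA.states quotient)
      module U = TransitionSystem U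
      module SU = Setoid U.states
    open Semantics U

    Rc⇒↔ : ∀ {s t} → Rc A c s t → s ↔ t
    Rc⇒↔ (u , s↠u , t↠u) = Q.trans (forwards s↠u) (Q.sym (forwards t↠u))
      where
      forwards : ∀ {s t} → s ↠ t → s ↔ t
      forwards = Star.map fwd

    -- Single steps lie in `Rc`, which is an equivalence by weak confluence and so contains the
    -- equivalence closure.
    ↔⇒Rc : ∀ {s t} → s ↔ t → Rc A c s t
    ↔⇒Rc = EqC.fold (Equivalence.isEquivalence (WeaklyConfluent.equivalence conf))
                    (λ {_} {t} st → t , st ◅ ε , ε)

    ≡[Rc]⇒≡[↔] : ∀ {μ ν : Distr states} → μ ≡[ Rc A c ] ν → μ ≡[ _↔_ ] ν
    ≡[Rc]⇒≡[↔] {μ} {ν} e z =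
      ≈ᵣ-trans (∑-cong ↔⇒Rc Rc⇒↔ (λ _ → ≈ᵣ-refl)) (≈ᵣ-trans (e z) (∑-cong Rc⇒↔ ↔⇒Rc (λ _ → ≈ᵣ-refl)))

    forget : U.State → State
    forget (inj₁ s) = s
    forget (inj₂ s) = s

    infix 4 _∼_

    _∼_ : Rel U.State 0ℓ
    x ∼ y = forget x ↔ forget y

    ∼-equivalence : Equivalence U.states _∼_
    ∼-equivalence = record
      { isEquivalence = record { refl = Q.refl ; sym = Q.sym ; trans = Q.trans }
      ; contains-≈    = λ { (inj₁ r) → r ; (inj₂ e) → EqC.return (inj₁ e) }
      }

    ∼-resp : ∀ {x y y′} → y SU.≈ y′ → x ∼ y → x ∼ y′
    ∼-resp {x} {y} {y′} e r = Q.trans r (Equivalence.contains-≈ ∼-equivalence {y} {y′} e)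

    -- The map is the identity, from states to classes. The fibre of `t` is then its class, so the
    -- condition on masses in the quotient's transitions holds by definition.
    lump : Distr states → Distr (PA.states quotient)
    lump = push {Y = PA.states quotient} (EqC.return ∘ inj₁)

    inl : Distr (PA.states quotient) → Distr U.states
    inl = push {Y = U.states} {i = inj₁} (λ e → inj₁ e)

    inr : Distr states → Distr U.states
    inr = push {Y = U.states} {i = inj₂} (λ e → inj₂ e)

    inl-mass : ∀ μ → (∀ s → mass (inl μ) (inj₁ s) ≈ᵣ mass μ s) × (∀ t → mass (inl μ) (inj₂ t) ≈ᵣ 0ᵣ)
    inl-mass μ = push-at {Y = U.states} (λ e → inj₁ e) (λ { (inj₁ e) → e }) μ , λ _ → ∑-zero λ ()

    inr-mass : ∀ μ → (∀ s → mass (inr μ) (inj₁ s) ≈ᵣ 0ᵣ) × (∀ t → mass (inr μ) (inj₂ t) ≈ᵣ mass μ t)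
    inr-mass μ = (λ _ → ∑-zero λ ()) , push-at {Y = U.states} (λ e → inj₂ e) (λ { (inj₂ e) → e }) μ

    𝟙-inj₂ : ∀ t → (∀ s → mass (𝟙 {U.states} (inj₂ t)) (inj₁ s) ≈ᵣ 0ᵣ) ×
                   (∀ s → mass (𝟙 {U.states} (inj₂ t)) (inj₂ s) ≈ᵣ mass (𝟙 {states} t) s)
    𝟙-inj₂ t = (λ _ → χ-no λ ()) , λ _ → χ-cong (λ { (inj₂ e) → e }) inj₂

    𝟙-≡[↔] : ∀ {s t} → s ↔ t → 𝟙 {states} s ≡[ _↔_ ] 𝟙 t
    𝟙-≡[↔] {s} {t} s↔t z with em {z ↔ s}
    ... | yes z↔s = ≈ᵣ-trans (𝟙-∈ z↔s) (≈ᵣ-sym (𝟙-∈ (Q.trans z↔s s↔t)))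
    ... | no ¬z↔s = ≈ᵣ-trans (𝟙-∉ move ¬z↔s) (≈ᵣ-sym (𝟙-∉ move (λ z↔t → ¬z↔s (Q.trans z↔t (Q.sym s↔t)))))
      where
      move : ∀ {u x} → x S.≈ u → z ↔ x → z ↔ u
      move e z↔x = Q.trans z↔x (EqC.return (inj₁ e))

    -- Distributions on the union are compared through one on the states of `A`: two with the same
    -- shadow agree on all classes of `_∼_`.
    Shadows : Distr U.states → Distr states → Set
    Shadows μ ν = ∀ z → μ ⟨ (λ x → z ↔ forget x) ⟩ ≈ᵣ ν ⟨ z ↔_ ⟩

    -- `μ` is the image of `μ₀`, and `μ₀` that of `ν`. The mass an image gives to a set closed under
    -- equality is the mass of the preimage; this is used once for each map.
    left-shadows : ∀ {μ μ₀ ν} → (∀ s → mass μ (inj₁ s) ≈ᵣ mass μ₀ s) × (∀ t → mass μ (inj₂ t) ≈ᵣ 0ᵣ) →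
                   (∀ t → mass μ₀ t ≈ᵣ ν ⟨ t ↔_ ⟩) → Shadows μ ν
    left-shadows {μ} {μ₀} {ν} (on-left , on-right) l z =
      ≈ᵣ-trans (⟨⟩-cong {μ = μ} {inl μ₀} _ extends)
        (≈ᵣ-trans (push-⟨⟩ {Y = U.states} (λ e → inj₁ e) μ₀ (λ {x} {y} → ∼-resp {inj₁ z} {x} {y}))
          (≈ᵣ-trans (⟨⟩-cong {μ = μ₀} {lump ν} (z ↔_) l)
            (push-⟨⟩ {Y = PA.states quotient} (EqC.return ∘ inj₁) ν (λ e r → Q.trans r e))))
      where
      extends : μ ≈ᵈ inl μ₀
      extends (inj₁ s) = ≈ᵣ-trans (on-left s) (≈ᵣ-sym (proj₁ (inl-mass μ₀) s))
      extends (inj₂ t) = ≈ᵣ-trans (on-right t) (≈ᵣ-sym (proj₂ (inl-mass μ₀) t))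

    right-shadows : ∀ {μ μ₀} → (∀ s → mass μ (inj₁ s) ≈ᵣ 0ᵣ) × (∀ t → mass μ (inj₂ t) ≈ᵣ mass μ₀ t) →
                    Shadows μ μ₀
    right-shadows {μ} {μ₀} (on-left , on-right) z =
      ≈ᵣ-trans (⟨⟩-cong {μ = μ} {inr μ₀} _ extends)
        (push-⟨⟩ {Y = U.states} (λ e → inj₂ e) μ₀ (λ {x} {y} → ∼-resp {inj₁ z} {x} {y}))
      where
      extends : μ ≈ᵈ inr μ₀
      extends (inj₁ s) = ≈ᵣ-trans (on-left s) (≈ᵣ-sym (proj₁ (inr-mass μ₀) s))
      extends (inj₂ t) = ≈ᵣ-trans (on-right t) (≈ᵣ-sym (proj₂ (inr-mass μ₀) t))

    -- A transition of a class stems from some member of it, which may differ from the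
    -- representative `forget x`.
    underlying : ∀ {x a μ} → U.Δ x a μ → ∃[ s ] ∃[ ν ] forget x ↔ s × Δ s a ν × Shadows μ ν
    underlying {inj₁ s} {μ = μ} (μ₀ , (s′ , ν , s↔s′ , d , l) , ext) =
      s′ , ν , s↔s′ , d , left-shadows {μ} {μ₀} {ν} ext l
    underlying {inj₂ s} {μ = μ} (ν , d , ext) = s , ν , Q.refl , d , right-shadows {μ} {ν} ext

    -- A `c`-path as a path of the union, in the form `run-⇒` asks for. The equality steps inside
    -- `_↠_` add no transition, so the last state agrees with `u` only up to `≈`.
    record Run (t u : State) : Set where
      field
        path   : Path
        starts : first path ≡ inj₂ t
        dirac  : Dirac U path
        silent : Silent _∼_ (inj₂ t) path
        ends   : ∃[ v ] last path ≡ inj₂ v × v S.≈ u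

    run-start : ∀ {t} → Run t t
    run-start {t} = record
      { path = start (inj₂ t) ; starts = refl ; dirac = tt ; silent = tt ; ends = t , refl , S.refl }

    run-step : ∀ {t u v} → t ↔ v → _→≈_ A c u v → Run t u → Run t v
    run-step t↔v (inj₁ u≈v) r = record
      { path = Run.path r ; starts = Run.starts r ; dirac = Run.dirac r ; silent = Run.silent r
      ; ends = let w , e , w≈u = Run.ends r in w , e , S.trans w≈u u≈v }
    run-step {t} {u} {v} t↔v (inj₂ u→v) r = let w , e , w≈u = Run.ends r in record
      { path   = extend (Run.path r) τ (𝟙 (inj₂ v))
                   -- The transition in `c` leaves `u`, whereas the path ends in `w`: `Δ-resp` moves
                   -- the source along `w ≈ u`.
                   (≡.subst (λ x → U.Δ x τ (𝟙 (inj₂ v))) (≡.sym e)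
                      ( 𝟙 v , Δ-resp (S.sym w≈u) (λ _ → ≈ᵣ-refl) (proj₁ (det u→v))
                      , 𝟙-inj₂ v))
                   (inj₂ v) (from (χ-yes SU.refl) Pos-1ᵣ)
      ; starts = Run.starts r
      ; dirac  = Run.dirac r , λ _ → ≈ᵣ-refl
      ; silent = Run.silent r , refl , t↔v
      ; ends   = v , refl , S.refl
      }

    run-↠ : ∀ {t u v} → t ↔ u → u ↠ v → Run t u → Run t v
    run-↠ t↔u ε        r = r
    -- Each new state is joined to `t` by `c`-steps, which keeps the run inside the class, as
    -- `Silent` requires.
    run-↠ t↔u (s ◅ ss) r = let t↔w = Q.trans t↔u (EqC.return s) in run-↠ t↔w ss (run-step t↔w s r)

    simulate : ∀ y {s a ν} → forget y ↔ s → Δ s a ν → ∃[ μ ] y ⇒[ a , _∼_ ] μ × Shadows μ ν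
    simulate (inj₁ t) {s} {a} {ν} t↔s d =
      inl (lump ν) ,
      -- The class of `t` has the transition because its member `s` does, so the run has no silent
      -- steps.
      run-⇒ U (λ {x} {y} {y′} → ∼-resp {x} {y} {y′}) {μ = inl (lump ν)} (start (inj₁ t)) refl tt tt
        (lump ν , (s , ν , t↔s , d , λ _ → ≈ᵣ-refl) , inl-mass (lump ν)) ,
      left-shadows {inl (lump ν)} {lump ν} {ν} (inl-mass (lump ν)) (λ _ → ≈ᵣ-refl)
    simulate (inj₂ t) {s} {a} {ν} t↔s d with ↔⇒Rc t↔s
    ... | u , t↠u , s↠u with WeaklyConfluent.confluent conf s↠u d
    ...   | t′ , u↠t′ , inj₁ (ν′ , d′ , ν≡ν′) =
      inr ν′ ,
      run-⇒ U (λ {x} {y} {y′} → ∼-resp {x} {y} {y′}) path starts dirac silent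
        (≡.subst (λ x → U.Δ x a (inr ν′)) (≡.sym at-w)
          (ν′ , Δ-resp (S.sym w≈t′) (λ _ → ≈ᵣ-refl) d′ , inr-mass ν′)) ,
      λ z → ≈ᵣ-trans (right-shadows {inr ν′} {ν′} (inr-mass ν′) z)
                     (≈ᵣ-sym (≡[Rc]⇒≡[↔] {ν} {ν′} ν≡ν′ z))
      where
      open Run (run-↠ Q.refl (t↠u ◅◅ u↠t′) run-start)
      at-w = proj₁ (proj₂ ends)
      w≈t′ = proj₂ (proj₂ ends)
    ...   | t′ , u↠t′ , inj₂ (refl , ν≡𝟙) =
      𝟙 (inj₂ t) , inj₁ (refl , λ _ → ≈ᵣ-refl) ,
      λ z → ≈ᵣ-trans (right-shadows {𝟙 (inj₂ t)} {𝟙 t} (𝟙-inj₂ t) z)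
              -- `t` reaches `t′` by `c`-steps, so `t′` is a common descendant of `t` and itself.
              (≈ᵣ-trans (𝟙-≡[↔] (Rc⇒↔ (t′ , t↠u ◅◅ u↠t′ , ε)) z)
                        (≈ᵣ-sym (≡[Rc]⇒≡[↔] {ν} {𝟙 t′} ν≡𝟙 z)))

    ∼-bisimulation : IsBranchingBisimulation _∼_
    ∼-bisimulation = record
      { equivalence = ∼-equivalence
      ; transfer    = λ {x} {y} x∼y {a} {μ} d →
          let s , ν , x↔s , d′ , sh = underlying {x} {a} {μ} d
              μ′ , y⇒μ′ , sh′      = simulate y (Q.trans (Q.sym x∼y) x↔s) d′
          in μ′ , y⇒μ′ , λ z → ≈ᵣ-trans (sh (forget z)) (≈ᵣ-sym (sh′ (forget z)))
      }

theorem22 : (em : ExcludedMiddle 0ℓ) → let open Classical em in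
    (L : Actions) (A : PA L) (c : TransitionSet A) →
    DeterministicTau A c → WeaklyConfluent A c →
    Bisimilar (A / ↔*-equivalence A c) A
theorem22 em L A c det conf =
  _∼_ A c det conf , ∼-bisimulation A c det conf ,
  -- Both initial states have the initial state of `A` underneath.
  Setoid.refl (PA.states (A / ↔*-equivalence A c)) {PA.init A}
  where
  open Proof em
  open Classical em
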